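{- Let $n\ge 1$, let $w\in\mathfrak S_n$ and let $I\subseteq J(w)$, where $J(w)=\{j\in[n-1]: w^{ -1}(j)>w^{ -1}(j+1)\}$. Write $D=[n-1]\setminus I=\{d_1<d_2<\dots<d_k\}$, $d_0:=0$, $d_{k+1}:=n$. Then the following two conditions are equivalent. (a) $w_0(I)\,w$ is a standard Coxeter element of some parabolic subgroup of $\mathfrak S_n$. (b) There exists a reduced expression $w=s_{i_1}s_{i_2}\cdots s_{i_{\ell(w)}}$ such that (S.1) for each $1\le i\le k$, $s_{d_i}$ appears at most once in it, i.e. $\#\{m: i_m=d_i\}\le 1$; and (S.2) $\#\{m: d_{t-1}<i_m<d_t\}<\binom{d_t-d_{t-1}+1}{2}$ for all $1\le t\le k+1$.
   Context: $\mathfrak S_n$ is the symmetric group on $[n]=\{1,\dots,n\}$, generated by the simple transpositions $s_i=(i\ i{+}1)$, $1\le i\le n-1$; $\ell$ is Coxeter length. Subsets of $[n-1]$ are identified with subsets of $\{s_1,\dots,s_{n-1}\}$. For $K\subseteq[n-1]$, $W_K$ is the parabolic subgroup generated by $\{s_i:i\in K\}$; a standard Coxeter element of $W_K$ is any product of the elements $s_i$, $i\in K$, each used exactly once, in some order (the identity if $K=\emptyset$). $w_0(I)$ is the longest element of $W_I$. -}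

module Defs where

open import Data.Fin.Base using (Fin; suc; toℕ; inject₁)
import Data.Fin.Base as Fin
open import Data.Fin.Properties using (_≟_)
open import Data.Fin.Permutation using (Permutation′; _⟨$⟩ˡ_; _∘ₚ_; _≈_; id; flip; transpose)
open import Data.Fin.Subset using (Subset; _∈_)
open import Data.Fin.Subset.Properties using (_∈?_)
open import Data.List.Base using (List; []; _∷_; _++_; [_]; map; filter; length; allFin)
open import Data.List.Relation.Unary.All using (All)
open import Data.List.Relation.Unary.Linked using (Linked)
open import Data.Nat.Base using (ℕ; suc; _+_; _∸_; _≤_; _<_)
open import Data.Nat.Combinatorics using (_C_)
open import Data.Nat.Properties using (_<?_)
open import Data.Product.Base using (_×_; ∃-syntax)
open import Level using (0ℓ)
open import Relation.Binary.PropositionalEquality.Core using (_≡_)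
open import Relation.Nullary.Decidable using (¬?; _×-dec_)
open import Relation.Unary using (Pred; Decidable)

-- Throughout n = suc m.  The element a of [n] is the index a - 1 of Fin (suc m),
-- and j ∈ [n-1] is the index j - 1 of Fin m.  Permutations are compared by
-- pointwise equality _≈_.

𝔖 : ℕ → Set
𝔖 = Permutation′

private
  variable
    m : ℕ

label : Fin m → ℕ
label i = suc (toℕ i)

-- u · v applies v first; stdlib's _∘ₚ_ is in diagrammatic order.
infixr 9 _·_
_·_ : 𝔖 m → 𝔖 m → 𝔖 m
u · v = v ∘ₚ u

s : Fin m → 𝔖 (suc m)
s i = transpose (inject₁ i) (suc i)

Word : ℕ → Set
Word m = List (Fin m)

⟦_⟧ : Word m → 𝔖 (suc m)
⟦ [] ⟧     = id
⟦ i ∷ is ⟧ = s i · ⟦ is ⟧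

Reduced : Word m → 𝔖 (suc m) → Set
Reduced x w = ⟦ x ⟧ ≈ w × (∀ y → ⟦ y ⟧ ≈ w → length x ≤ length y)

-- Coxeter length, as the relation "ℓ(w) = k".
ℓ_≔_ : 𝔖 (suc m) → ℕ → Set
ℓ w ≔ k = ∃[ x ] (Reduced x w × length x ≡ k)

data W {m : ℕ} (K : Subset m) : Pred (𝔖 (suc m)) 0ℓ where
  gen  : ∀ {i} → i ∈ K → W K (s i)
  unit : W K id
  mul  : ∀ {u v} → W K u → W K v → W K (u · v)
  inv  : ∀ {u} → W K u → W K (flip u)
  resp : ∀ {u v} → u ≈ v → W K u → W K v

IsLongest : Subset m → 𝔖 (suc m) → Set
IsLongest I u = W I u × (∀ {v a b} → W I v → ℓ v ≔ a → ℓ u ≔ b → a ≤ b)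

#_∈_ : {P : Pred (Fin m) 0ℓ} → Decidable P → Word m → ℕ
# P? ∈ x = length (filter P? x)

StandardCoxeter : Subset m → 𝔖 (suc m) → Set
StandardCoxeter K c =
  ∃[ x ] (All (_∈ K) x × (∀ {i} → i ∈ K → # (_≟ i) ∈ x ≡ 1) × ⟦ x ⟧ ≈ c)

J : 𝔖 (suc m) → Pred (Fin m) 0ℓ
J w j = (w ⟨$⟩ˡ suc j) Fin.< (w ⟨$⟩ˡ inject₁ j)

-- d₁ < ... < d_k: allFin is increasing, and filter keeps the order.
D : Subset m → List (Fin m)
D {m} I = filter (λ i → ¬? (i ∈? I)) (allFin m)

-- d₀ < d₁ < ... < d_k < d_{k+1}, as natural numbers.
cuts : Subset m → List ℕ
cuts {m} I = 0 ∷ map label (D I) ++ [ suc m ]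

S1 : Subset m → Word m → Set
S1 I x = All (λ d → # (_≟ d) ∈ x ≤ 1) (D I)

-- Linked ranges over the consecutive pairs (d_{t-1} , d_t), 1 ≤ t ≤ k + 1.
S2 : Subset m → Word m → Set
S2 I x = Linked (λ a b → # (λ i → (a <? label i) ×-dec (label i <? b)) ∈ x < ((b ∸ a) + 1) C 2) (cuts I)

{-# OPTIONS --safe #-}
module Submission where

open import Defs
open import Algebra.Properties.CommutativeSemigroup using (x∙yz≈y∙xz)
open import Data.Empty using (⊥; ⊥-elim)
open import Data.Fin.Base using (Fin; zero; suc; toℕ; fromℕ<; inject₁)
open import Data.Fin.Permutation using (_⟨$⟩ˡ_; _⟨$⟩ʳ_; _≈_; inverseˡ; inverseʳ; flip)
open import Data.Fin.Properties using (_≟_; toℕ-injective; toℕ-fromℕ<; toℕ<n; toℕ-inject₁)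
open import Data.Fin.Subset using (Subset; _∈_; _∉_)
open import Data.Fin.Subset.Properties using (_∈?_)
open import Data.List.Base using ([]; _∷_; _++_; [_]; filter; length; reverse; allFin; map)
import Data.List.Membership.DecPropositional as DecMembership
open import Data.List.Membership.Propositional using (find) renaming (_∈_ to _∈ₗ_; _∉_ to _∉ₗ_)
open import Data.List.Membership.Propositional.Properties
  using (∈-∃++; ∈-++⁺ˡ; ∈-++⁺ʳ; ∈-++⁻; ∈-filter⁺; ∈-filter⁻; ∈-allFin; ∈-map⁺)
open import Data.List.Properties
  using (length-++; length-reverse; filter-++; filter-accept; filter-reject;
         unfold-reverse; reverse-involutive; ++-assoc)
open import Data.List.Relation.Unary.All as All using (All; []; _∷_)
import Data.List.Relation.Unary.All.Properties as All
open import Data.List.Relation.Unary.AllPairs using (AllPairs; []; _∷_)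
import Data.List.Relation.Unary.AllPairs.Properties as AllPairs
open import Data.List.Relation.Unary.Any as Any using (any?; here; there)
open import Data.List.Relation.Unary.Any.Properties using (reverse⁻)
open import Data.List.Relation.Unary.Linked as Linked using (Linked; [-]; _∷_)
open import Data.List.Reverse using (Reverse; reverseView; []; _∶_∶ʳ_)
open import Data.Nat.Base using (ℕ; zero; suc; _+_; _∸_; _≤_; _<_; z≤n; s≤s; s≤s⁻¹)
open import Data.Nat.Combinatorics using (_C_; nC1≡n; nCk+nC[k+1]≡[n+1]C[k+1])
open import Data.Nat.Properties as ℕ hiding (_≟_)
open import Data.Nat.Solver using (module +-*-Solver)
open import Data.Product.Base using (_×_; _,_; ∃-syntax; ∃₂; proj₁; proj₂)
open import Data.Sum.Base using (_⊎_; inj₁; inj₂)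
open import Data.Vec.Base using (tabulate)
open import Data.Vec.Properties using (lookup∘tabulate; lookup⇒[]=; []=⇒lookup)
open import Function.Base using (_∘_)
open import Function.Bundles using (_⇔_; mk⇔)
open import Level using (0ℓ)
open import Relation.Binary.Definitions using (Transitive; tri<; tri≈; tri>)
open import Relation.Binary.PropositionalEquality hiding ([_]; J)
open import Relation.Nullary using (¬_; Dec; yes; no; contradiction)
open import Relation.Nullary.Decidable using (does; dec-true; ¬?; _×-dec_; _⊎-dec_)
open import Relation.Unary using (Pred; Decidable)

-- Write w = w₀(I) c.  Since I consists of left descents of w, lengths add up, and c
-- has no left descent in I.
--
-- (a) ⇒ (b): concatenate reduced words of w₀(I) and of c.  A block (d_{t-1}, d_t) of
-- size L = d_t - d_{t-1} receives at most C(L,2) letters from the first word and at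
-- most L - 1 from the second, and C(L,2) + L - 1 < C(L+1,2).
--
-- (b) ⇒ (a): by the exchange property, c has a word z obtained from the given word of w
-- by deleting one letter for each letter of w₀(I).  As every s_{d_i} occurs at most
-- once, two tokens of a block cannot meet outside that block, so each deleted letter
-- lies in the block of the letter it is deleted for: z has fewer than L letters in a
-- block of size L.  If z repeated a letter i of a block, some letter k of this
-- block would be missing from z.  Since c has no left descent in I, the letters from i
-- towards k occur in z in the order leading away from i, and then a braid move
-- or a cancellation at the second i contradicts reducedness or the absence of descents.

-- Adjacent transpositions of the natural numbers.

private
  variable
    m : ℕ

-- The transposition of `i` and `suc i` on all of ℕ. Structural recursion reduces the Coxeter
-- relations to a few base cases, and natural numbers spare the casts between `Fin m` and
-- `Fin (suc m)`.
σ : ℕ → ℕ → ℕ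
σ zero    zero          = 1
σ zero    (suc zero)    = 0
σ zero    (suc (suc p)) = suc (suc p)
σ (suc i) zero          = zero
σ (suc i) (suc p)       = suc (σ i p)

σ-involutive : ∀ i p → σ i (σ i p) ≡ p
σ-involutive zero    zero          = refl
σ-involutive zero    (suc zero)    = refl
σ-involutive zero    (suc (suc p)) = refl
σ-involutive (suc i) zero          = refl
σ-involutive (suc i) (suc p)       = cong suc (σ-involutive i p)

σ-injective : ∀ i {p q} → σ i p ≡ σ i q → p ≡ q
σ-injective i {p} {q} e =
  trans (sym (σ-involutive i p)) (trans (cong (σ i) e) (σ-involutive i q))

σ-left : ∀ i → σ i i ≡ suc i
σ-left zero    = refl
σ-left (suc i) = cong suc (σ-left i)

σ-right : ∀ i → σ i (suc i) ≡ i
σ-right zero    = refl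
σ-right (suc i) = cong suc (σ-right i)

σ-fix : ∀ i p → p ≢ i → p ≢ suc i → σ i p ≡ p
σ-fix zero    zero          p≢i _   = contradiction refl p≢i
σ-fix zero    (suc zero)    _   p≢1 = contradiction refl p≢1
σ-fix zero    (suc (suc p)) _   _   = refl
σ-fix (suc i) zero          _   _   = refl
σ-fix (suc i) (suc p) p≢i p≢1+i =
  cong suc (σ-fix i p (p≢i ∘ cong suc) (p≢1+i ∘ cong suc))

σ-≤ : ∀ {i d p} → i ≢ d → p ≤ d → σ i p ≤ d
σ-≤ {zero}  {zero}  {p}           i≢d _        = contradiction refl i≢d
σ-≤ {zero}  {suc d} {zero}        _   _        = s≤s z≤n
σ-≤ {zero}  {suc d} {suc zero}    _   _        = z≤n
σ-≤ {zero}  {suc d} {suc (suc p)} _   p≤d      = p≤d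
σ-≤ {suc i} {d}     {zero}        _   _        = z≤n
σ-≤ {suc i} {suc d} {suc p}       i≢d (s≤s p≤d) = s≤s (σ-≤ (i≢d ∘ cong suc) p≤d)

σ-> : ∀ {i d p} → i ≢ d → d < p → d < σ i p
σ-> {i} {d} {p} i≢d d<p = ≰⇒> λ σp≤d →
  <⇒≱ d<p (subst (_≤ d) (σ-involutive i p) (σ-≤ i≢d σp≤d))

σ-mono : ∀ i {p q} → p < q → (p ≡ i × q ≡ suc i) ⊎ σ i p < σ i q
σ-mono zero    {zero}        {suc zero}    _       = inj₁ (refl , refl)
σ-mono zero    {zero}        {suc (suc q)} _       = inj₂ (s≤s (s≤s z≤n))
σ-mono zero    {suc zero}    {suc (suc q)} _       = inj₂ (s≤s z≤n)
σ-mono zero    {suc _}       {suc zero}    (s≤s ())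
σ-mono zero    {suc (suc p)} {suc (suc q)} p<q     = inj₂ p<q
σ-mono (suc i) {zero}        {suc q}       _       = inj₂ (s≤s z≤n)
σ-mono (suc i) {suc p}       {suc q} (s≤s p<q) with σ-mono i p<q
... | inj₁ (refl , refl) = inj₁ (refl , refl)
... | inj₂ lt            = inj₂ (s≤s lt)

σ-comm : ∀ {i j} → suc i < j → ∀ p → σ i (σ j p) ≡ σ j (σ i p)
σ-comm {zero}  {suc zero}    (s≤s ())
σ-comm {zero}  {suc (suc j)} _           zero          = refl
σ-comm {zero}  {suc (suc j)} _           (suc zero)    = refl
σ-comm {zero}  {suc (suc j)} _           (suc (suc p)) = refl
σ-comm {suc i} {suc j}       _           zero          = refl
σ-comm {suc i} {suc j}       (s≤s 1+i<j) (suc p)       = cong suc (σ-comm 1+i<j p)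

σ-braid : ∀ i p → σ i (σ (suc i) (σ i p)) ≡ σ (suc i) (σ i (σ (suc i) p))
σ-braid zero    zero                = refl
σ-braid zero    (suc zero)          = refl
σ-braid zero    (suc (suc zero))    = refl
σ-braid zero    (suc (suc (suc p))) = refl
σ-braid (suc i) zero                = refl
σ-braid (suc i) (suc p)             = cong suc (σ-braid i p)

-- Words acting on tokens.

-- pos x p is ⟦ x ⟧⁻¹ (p), extended to all of ℕ by fixing every p > m.
pos : Word m → ℕ → ℕ
pos []      p = p
pos (i ∷ x) p = pos x (σ (toℕ i) p)

infix 4 _≅_
-- Equality of the permutations spelled by two words, since `pos` fixes everything above `m`. A
-- record, unlike a bare function type, lets the two words be inferred.
record _≅_ (x y : Word m) : Set where
  constructor pointwise
  field at : ∀ p → pos x p ≡ pos y p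
open _≅_ public

≅-refl : {x : Word m} → x ≅ x
≅-refl .at p = refl

≅-sym : {x y : Word m} → x ≅ y → y ≅ x
≅-sym e .at p = sym (e .at p)

≅-trans : {x y z : Word m} → x ≅ y → y ≅ z → x ≅ z
≅-trans e f .at p = trans (e .at p) (f .at p)

pos-++ : (x y : Word m) → ∀ p → pos (x ++ y) p ≡ pos y (pos x p)
pos-++ []      y p = refl
pos-++ (i ∷ x) y p = pos-++ x y (σ (toℕ i) p)

pos-injective : (x : Word m) → ∀ {p q} → pos x p ≡ pos x q → p ≡ q
pos-injective []      e = e
pos-injective (i ∷ x) e = σ-injective (toℕ i) (pos-injective x e)

pos-reverse : (x : Word m) → ∀ p → pos (reverse x) (pos x p) ≡ p
pos-reverse []      p = refl
pos-reverse (i ∷ x) p rewrite unfold-reverse i x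
  | pos-++ (reverse x) [ i ] (pos x (σ (toℕ i) p))
  | pos-reverse x (σ (toℕ i) p) = σ-involutive (toℕ i) p

pos-reverse′ : (x : Word m) → ∀ p → pos x (pos (reverse x) p) ≡ p
pos-reverse′ x p = subst (λ y → pos y (pos (reverse x) p) ≡ p) (reverse-involutive x)
  (pos-reverse (reverse x) p)

∷-cong : (j : Fin m) {x y : Word m} → x ≅ y → j ∷ x ≅ j ∷ y
∷-cong j e .at p = e .at _

∷-cancel : {j : Fin m} {x y : Word m} → x ≅ j ∷ y → j ∷ x ≅ y
∷-cancel {j = j} {y = y} e .at p =
  trans (e .at _) (cong (pos y) (σ-involutive (toℕ j) p))

++-congʳ : (x : Word m) {y z : Word m} → y ≅ z → x ++ y ≅ x ++ z
++-congʳ x {y} {z} e .at p = trans (pos-++ x y p) (trans (e .at _) (sym (pos-++ x z p)))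

++-congˡ : {x y : Word m} (z : Word m) → x ≅ y → x ++ z ≅ y ++ z
++-congˡ {x = x} {y} z e .at p =
  trans (pos-++ x z p) (trans (cong (pos z) (e .at p)) (sym (pos-++ y z p)))

reverse-cong : {x y : Word m} → x ≅ y → reverse x ≅ reverse y
reverse-cong {x = x} {y} e .at p = pos-injective y (trans (sym (e .at _))
  (trans (pos-reverse′ x p) (sym (pos-reverse′ y p))))

-- The letter `d` is a wall between the places `d` and `d + 1`: no other letter carries a token
-- across it.
pos-≤ : (x : Word m) → ∀ {d p} → All (λ i → toℕ i ≢ d) x → p ≤ d → pos x p ≤ d
pos-≤ []      _           p≤d = p≤d
pos-≤ (i ∷ x) (i≢d ∷ x∌d) p≤d = pos-≤ x x∌d (σ-≤ i≢d p≤d)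

pos-> : (x : Word m) → ∀ {d p} → All (λ i → toℕ i ≢ d) x → d < p → d < pos x p
pos-> []      _           d<p = d<p
pos-> (i ∷ x) (i≢d ∷ x∌d) d<p = pos-> x x∌d (σ-> i≢d d<p)

-- Left descents, exchange and reduced words.

Ascent : Word m → Fin m → Set
Ascent x j = pos x (toℕ j) < pos x (suc (toℕ j))

-- As `pos x` is the inverse permutation, this is a left descent: prepending `j` shortens the
-- element.
Descent : Word m → Fin m → Set
Descent x j = pos x (suc (toℕ j)) < pos x (toℕ j)

ascent-or-descent : (x : Word m) (j : Fin m) → Ascent x j ⊎ Descent x j
ascent-or-descent x j with <-cmp (pos x (toℕ j)) (pos x (suc (toℕ j)))
... | tri< a _ _ = inj₁ a
... | tri≈ _ e _ = contradiction (pos-injective x e) (<⇒≢ (n<1+n _))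
... | tri> _ _ d = inj₂ d

Descent-∷ : (x : Word m) (j : Fin m) → Ascent x j → Descent (j ∷ x) j
Descent-∷ x j asc rewrite σ-left (toℕ j) | σ-right (toℕ j) = asc

Descent-≅ : {x y : Word m} (j : Fin m) → x ≅ y → Descent x j → Descent y j
Descent-≅ j e = subst₂ _<_ (e .at _) (e .at _)

-- The moment in `x` when the tokens `p` and `q` pass each other: `before` makes them neighbours and
-- `letter` exchanges them.
record Inversion (x : Word m) (p q : ℕ) : Set where
  constructor inversion
  field
    before   : Word m
    letter   : Fin m
    after    : Word m
    split    : x ≡ before ++ letter ∷ after
    pos-low  : pos before p ≡ toℕ letter
    pos-high : pos before q ≡ suc (toℕ letter)

-- By `σ-mono` a letter keeps two tokens in order unless it exchanges them, so tokens that end in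
-- the wrong order met at some letter.
find-inversion : (x : Word m) → ∀ {p q} → p < q → pos x q < pos x p → Inversion x p q
find-inversion []      p<q q<p = contradiction q<p (<⇒≯ p<q)
find-inversion (i ∷ x) p<q q<p with σ-mono (toℕ i) p<q
... | inj₁ (refl , refl) = inversion [] i x refl refl refl
... | inj₂ σp<σq with find-inversion x σp<σq q<p
... | inversion u k v refl lo hi = inversion (i ∷ u) k v refl lo hi

-- The exchange property. `before` takes `j` and `j + 1` to `k` and `k + 1`, where `k` is `letter`,
-- hence conjugates `s j` into `s k`; an extra `j` in front thus amounts to striking out this `k`.
deletion : (x : Word m) (j : Fin m) (inv : Inversion x (toℕ j) (suc (toℕ j))) →
           let open Inversion inv in before ++ after ≅ j ∷ x
deletion x j (inversion u k v refl lo hi) .at r =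
  trans (pos-++ u v r) (sym (begin
    pos (u ++ k ∷ v) (σ (toℕ j) r)           ≡⟨ pos-++ u (k ∷ v) _ ⟩
    pos v (σ (toℕ k) (pos u (σ (toℕ j) r)))  ≡⟨ cong (pos v) (conjugate r) ⟩
    pos v (pos u r)                          ∎))
  where
  open ≡-Reasoning
  conjugate : ∀ r → σ (toℕ k) (pos u (σ (toℕ j) r)) ≡ pos u r
  conjugate r with r ℕ.≟ toℕ j
  ... | yes refl rewrite σ-left (toℕ j) | hi | lo = σ-right (toℕ k)
  ... | no r≢j with r ℕ.≟ suc (toℕ j)
  ... | yes refl rewrite σ-right (toℕ j) | lo | hi = σ-left (toℕ k)
  ... | no r≢1+j rewrite σ-fix (toℕ j) r r≢j r≢1+j = σ-fix (toℕ k) (pos u r)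
    (λ e → r≢j (pos-injective u (trans e (sym lo))))
    (λ e → r≢1+j (pos-injective u (trans e (sym hi))))

length-deletion : (u : Word m) {k : Fin m} (v : Word m) →
                  length (u ++ k ∷ v) ≡ suc (length (u ++ v))
length-deletion []      v = refl
length-deletion (i ∷ u) v = cong suc (length-deletion u v)

record Minimal (x : Word m) : Set where
  constructor minimal
  field shortest : ∀ {y} → y ≅ x → length x ≤ length y
open Minimal public

Minimal-≅ : {x y : Word m} → Minimal x → y ≅ x → length y ≤ length x → Minimal y
Minimal-≅ mx e le .shortest z≅y = ≤-trans le (mx .shortest (≅-trans z≅y e))

descent-deletion : (x : Word m) (j : Fin m) → Descent x j →
                   ∃[ y ] (y ≅ j ∷ x × length x ≡ suc (length y))
descent-deletion x j d with find-inversion x (n<1+n _) d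
... | i@(inversion u k v refl _ _) =
  u ++ v , deletion x j i , length-deletion u v

Minimal-deletion : {x y : Word m} {j : Fin m} → Minimal x → y ≅ j ∷ x →
                   length x ≡ suc (length y) → Minimal y
Minimal-deletion {j = j} mx e l .shortest {z} z≅y = s≤s⁻¹ (subst (_≤ suc (length z)) l
  (mx .shortest (∷-cancel (≅-trans z≅y e))))

-- Every word for `j ∷ x` has the descent `j`, so exchange turns it into a word for `x` with one
-- letter less.
Minimal-∷⁺ : {x : Word m} (j : Fin m) → Minimal x → Ascent x j → Minimal (j ∷ x)
Minimal-∷⁺ {x = x} j mx asc .shortest {y} y≅jx
  with descent-deletion y j (Descent-≅ j (≅-sym y≅jx) (Descent-∷ x j asc))
... | z , z≅jy , l = subst (suc (length x) ≤_) (sym l)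
  (s≤s (mx .shortest (≅-trans z≅jy (∷-cancel y≅jx))))

Minimal-∷⁻ : {x : Word m} {j : Fin m} → Minimal (j ∷ x) → Minimal x × Ascent x j
Minimal-∷⁻ {x = x} {j} mjx = mx , asc
  where
  mx : Minimal x
  mx .shortest {y} y≅x = s≤s⁻¹ (mjx .shortest (∷-cong j y≅x))
  asc : Ascent x j
  asc with ascent-or-descent x j
  ... | inj₁ a = a
  ... | inj₂ d with descent-deletion x j d
  -- Exchange gave a word `y` for `j ∷ x` that is shorter than `x`, against minimality.
  ... | y , y≅jx , l = ⊥-elim (<⇒≱ (n<1+n (length y))
    (≤-trans (n≤1+n _) (subst (_≤ length y) (cong suc l) (mjx .shortest y≅jx))))

-- The lengths make `j ∷ y` minimal as well, so `j` is an ascent of `y` and a descent of `j ∷ y`.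
Minimal-descent : {x y : Word m} {j : Fin m} → Minimal x → x ≅ j ∷ y →
                  length x ≡ suc (length y) → Descent x j
Minimal-descent {y = y} {j} mx e l = Descent-≅ j (≅-sym e)
  (Descent-∷ y j (proj₂ (Minimal-∷⁻ (Minimal-≅ mx (≅-sym e) (≤-reflexive (sym l))))))

Minimal-++ˡ : (x : Word m) {y : Word m} → Minimal (x ++ y) → Minimal x
Minimal-++ˡ x {y} mxy .shortest {z} z≅x = +-cancelʳ-≤ (length y) _ _
  (subst₂ _≤_ (length-++ x) (length-++ z) (mxy .shortest (++-congˡ y z≅x)))

Minimal-reverse : {x : Word m} → Minimal x → Minimal (reverse x)
Minimal-reverse {x = x} mx .shortest {y} e = subst₂ _≤_ (sym (length-reverse x)) (length-reverse y)
  (mx .shortest (subst (reverse y ≅_) (reverse-involutive x) (reverse-cong e)))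

-- Letters are only ever deleted, so `P` passes to the reduced word.
minimise : {P : Pred (Fin m) 0ℓ} (x : Word m) → All P x →
           ∃[ y ] (y ≅ x × Minimal y × All P y)
minimise [] _ = [] , ≅-refl , (minimal λ _ → z≤n) , []
minimise (j ∷ x) (pj ∷ px) with minimise x px
... | y , y≅x , my , py with ascent-or-descent y j
... | inj₁ a = j ∷ y , ∷-cong j y≅x , Minimal-∷⁺ j my a , pj ∷ py
... | inj₂ d with find-inversion y (n<1+n _) d
... | i@(inversion u k v refl _ _) =
  u ++ v , ≅-trans del (∷-cong j y≅x) , Minimal-deletion my del (length-deletion u v) ,
  All.++⁺ (All.++⁻ˡ u py) (All.tail (All.++⁻ʳ u py))
  where del = deletion y j i

-- Counting letters.

module _ {P : Pred (Fin m) 0ℓ} (P? : Decidable P) where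

  count-++ : (x y : Word m) → # P? ∈ (x ++ y) ≡ # P? ∈ x + # P? ∈ y
  count-++ x y = trans (cong length (filter-++ P? x y)) (length-++ (filter P? x))

  count-yes : ∀ {i} (x : Word m) → P i → # P? ∈ (i ∷ x) ≡ suc (# P? ∈ x)
  count-yes x Pi = cong length (filter-accept P? Pi)

  count-no : ∀ {i} (x : Word m) → ¬ P i → # P? ∈ (i ∷ x) ≡ # P? ∈ x
  count-no x ¬Pi = cong length (filter-reject P? ¬Pi)

  count-≤-∷ : ∀ i (x : Word m) → # P? ∈ x ≤ # P? ∈ (i ∷ x)
  count-≤-∷ i x with P? i
  ... | yes _ = n≤1+n _
  ... | no  _ = ≤-refl

  count-insert : (u : Word m) (k : Fin m) (v : Word m) →
                 # P? ∈ (u ++ k ∷ v) ≡ # P? ∈ (k ∷ u ++ v)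
  count-insert u k v = trans (count-++ u (k ∷ v)) move
    where
    move : # P? ∈ u + # P? ∈ (k ∷ v) ≡ # P? ∈ (k ∷ u ++ v)
    move with P? k
    ... | yes _ = trans (+-suc _ _) (cong suc (sym (count-++ u v)))
    ... | no  _ = sym (count-++ u v)

  count-none : (x : Word m) → # P? ∈ x ≤ 0 → All (λ i → ¬ P i) x
  count-none []      _ = []
  count-none (i ∷ x) le with P? i
  ... | no ¬Pi = ¬Pi ∷ count-none x le

  count-∈ : ∀ {i x} → i ∈ₗ x → P i → 0 < # P? ∈ x
  count-∈ {x = j ∷ x} (here refl) Pi = subst (0 <_) (sym (count-yes x Pi)) (s≤s z≤n)
  count-∈ {x = j ∷ x} (there i∈x) Pi = ≤-trans (count-∈ i∈x Pi) (count-≤-∷ j x)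

  count-letter : ∀ {i j} → (P i → P j) → (P j → P i) → # P? ∈ [ i ] ≡ # P? ∈ [ j ]
  count-letter {i} {j} to from with P? i | P? j
  ... | yes _  | yes _  = refl
  ... | yes Pi | no ¬Pj = contradiction (to Pi) ¬Pj
  ... | no ¬Pi | yes Pj = contradiction (from Pj) ¬Pi
  ... | no _   | no _   = refl

  count-∉ : (x : Word m) → All (λ i → ¬ P i) x → # P? ∈ x ≡ 0
  count-∉ []      _           = refl
  count-∉ (i ∷ x) (¬Pi ∷ ¬Px) = trans (count-no x ¬Pi) (count-∉ x ¬Px)

-- Walls crossed at most once, and places in the same block.

Once : Word m → Fin m → Set
Once x d = # (_≟ d) ∈ x ≤ 1

once-∷ : {d : Fin m} (x : Word m) → Once (d ∷ x) d → All (_≢ d) x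
once-∷ {d = d} x o = count-none (_≟ d) x (s≤s⁻¹ (subst (_≤ 1) (count-yes (_≟ d) x refl) o))

once-split : {d : Fin m} (u v : Word m) → Once (u ++ d ∷ v) d → All (_≢ d) u × All (_≢ d) v
once-split {d = d} u v o with once-∷ (u ++ v) (subst (_≤ 1) (count-insert (_≟ d) u d v) o)
... | a = All.++⁻ˡ u a , All.++⁻ʳ u a

once-++ˡ : {d : Fin m} (u : Word m) {v : Word m} → Once (u ++ v) d → Once u d
once-++ˡ {d = d} u {v} o =
  ≤-trans (m≤m+n _ _) (subst (_≤ 1) (count-++ (_≟ d) u v) o)

once-insert : {d : Fin m} (u : Word m) (k : Fin m) (v : Word m) → Once (u ++ k ∷ v) d → Once (u ++ v) d
once-insert {d = d} u k v o =
  ≤-trans (count-≤-∷ (_≟ d) k (u ++ v)) (subst (_≤ 1) (count-insert (_≟ d) u k v) o)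

avoid-toℕ : {d : Fin m} {x : Word m} → All (_≢ d) x → All (λ i → toℕ i ≢ toℕ d) x
avoid-toℕ = All.map (λ i≢d → i≢d ∘ toℕ-injective)

-- No letter has the value `m`, so `m` is a wall for every word.
pos-≤m : (x : Word m) {p : ℕ} → p ≤ m → pos x p ≤ m
pos-≤m x = pos-≤ x (All.universal (λ i → <⇒≢ (toℕ<n i)) x)

pos->m : (x : Word m) {p : ℕ} → m < p → pos x p ≡ p
pos->m []      _   = refl
pos->m (i ∷ x) m<p rewrite σ-fix (toℕ i) _ (>⇒≢ (<-trans (toℕ<n i) m<p))
                                           (>⇒≢ (≤-<-trans (toℕ<n i) m<p)) = pos->m x m<p

-- A letter occurring once moves only one token across its wall.
one-stays-≤ : (x : Word m) {d : Fin m} → Once x d → ∀ {p q} → p ≢ q →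
              p ≤ toℕ d → q ≤ toℕ d → pos x p ≤ toℕ d ⊎ pos x q ≤ toℕ d
one-stays-≤ []      _ _ p≤d _ = inj₁ p≤d
one-stays-≤ (i ∷ x) {d} o {p} {q} p≢q p≤d q≤d with i ≟ d
... | no i≢d = one-stays-≤ x o (p≢q ∘ σ-injective (toℕ i))
  (σ-≤ (i≢d ∘ toℕ-injective) p≤d) (σ-≤ (i≢d ∘ toℕ-injective) q≤d)
-- The single `d` carries only the token at `toℕ d` up over the wall, and the rest of the word
-- carries none.
... | yes refl with avoid-toℕ (count-none (_≟ d) x (s≤s⁻¹ o)) | p ℕ.≟ toℕ d
... | x∌d | no p≢d rewrite σ-fix (toℕ d) p p≢d (<⇒≢ (s≤s p≤d)) = inj₁ (pos-≤ x x∌d p≤d)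
... | x∌d | yes refl rewrite σ-fix (toℕ d) q (≢-sym p≢q) (<⇒≢ (s≤s q≤d)) =
  inj₂ (pos-≤ x x∌d q≤d)

one-stays-> : (x : Word m) {d : Fin m} → Once x d → ∀ {p q} → p ≢ q →
              toℕ d < p → toℕ d < q → toℕ d < pos x p ⊎ toℕ d < pos x q
one-stays-> []      _ _ d<p _ = inj₁ d<p
one-stays-> (i ∷ x) {d} o {p} {q} p≢q d<p d<q with i ≟ d
... | no i≢d = one-stays-> x o (p≢q ∘ σ-injective (toℕ i))
  (σ-> (i≢d ∘ toℕ-injective) d<p) (σ-> (i≢d ∘ toℕ-injective) d<q)
... | yes refl with avoid-toℕ (count-none (_≟ d) x (s≤s⁻¹ o)) | p ℕ.≟ suc (toℕ d)
... | x∌d | no p≢d rewrite σ-fix (toℕ d) p (>⇒≢ d<p) p≢d = inj₁ (pos-> x x∌d d<p)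
... | x∌d | yes refl rewrite σ-fix (toℕ d) q (>⇒≢ d<q) (≢-sym p≢q) =
  inj₂ (pos-> x x∌d d<q)

-- For places up to `m` this says that they lie in one orbit of W_I: no wall outside `I` separates
-- them.
record SameBlock (I : Subset m) (p q : ℕ) : Set where
  constructor same
  field
    ≤⇒ : ∀ {d} → d ∉ I → p ≤ toℕ d → q ≤ toℕ d
    ≤⇐ : ∀ {d} → d ∉ I → q ≤ toℕ d → p ≤ toℕ d
open SameBlock public

Inside : ℕ → ℕ → Fin m → Set
Inside a b i = a < label i × label i < b

-- This is the decision procedure written out in `S2`, so the counts agree by computation.
inside? : ∀ a b → Decidable (Inside {m} a b)
inside? a b i = (a <? label i) ×-dec (label i <? b)

module _ {I : Subset m} where

  same-refl : ∀ {p} → SameBlock I p p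
  same-refl = same (λ _ le → le) (λ _ le → le)

  same-sym : ∀ {p q} → SameBlock I p q → SameBlock I q p
  same-sym s = same (s .≤⇐) (s .≤⇒)

  same-trans : ∀ {p q r} → SameBlock I p q → SameBlock I q r → SameBlock I p r
  same-trans s t = same (λ d∉I → t .≤⇒ d∉I ∘ s .≤⇒ d∉I) (λ d∉I → s .≤⇐ d∉I ∘ t .≤⇐ d∉I)

  same-suc : ∀ {j} → j ∈ I → SameBlock I (toℕ j) (suc (toℕ j))
  same-suc {j} j∈I = same
    (λ {d} d∉I j≤d → ≤∧≢⇒< j≤d (λ e → d∉I (subst (_∈ I) (toℕ-injective e) j∈I)))
    (λ _ → <⇒≤)

  same-σ : ∀ {j} → j ∈ I → ∀ p → SameBlock I p (σ (toℕ j) p)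
  same-σ {j} j∈I p = same
    (λ d∉I → σ-≤ (j≢ d∉I))
    (λ {d} d∉I → subst (_≤ toℕ d) (σ-involutive (toℕ j) p) ∘ σ-≤ (j≢ d∉I))
    where
    j≢ : ∀ {d} → d ∉ I → toℕ j ≢ toℕ d
    j≢ d∉I e = d∉I (subst (_∈ I) (toℕ-injective e) j∈I)

  same-pos : (y : Word m) → All (_∈ I) y → ∀ p → SameBlock I p (pos y p)
  same-pos []      _           p = same-refl
  same-pos (j ∷ y) (j∈I ∷ y⊆I) p =
    same-trans (same-σ j∈I p) (same-pos y y⊆I (σ (toℕ j) p))

  module _ {R : ℕ → ℕ → Set} (R-trans : Transitive R)
           (R-suc : ∀ {j} → j ∈ I → R (toℕ j) (suc (toℕ j))) where

    spread-last : ∀ {p q} → SameBlock I p (suc q) → p ≤ q → q < m →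
                  R q (suc q) × SameBlock I p q
    spread-last {p} s p≤q q<m with fromℕ< q<m | toℕ-fromℕ< q<m
    ... | k | refl with k ∈? I
    ... | yes k∈I = R-suc k∈I , same-trans s (same-sym (same-suc k∈I))
    -- A letter `k` outside `I` at this place would separate `p` from `suc q`.
    ... | no  k∉I = contradiction (s .≤⇒ k∉I p≤q) (<⇒≱ (n<1+n _))

    -- No wall outside `I` lies between `p` and `q`, so single steps compose. With `R` saying that a
    -- word keeps, or reverses, the order of two places, ascents or descents at the letters of `I`
    -- extend to whole blocks.
    spread : ∀ {p q} → SameBlock I p q → p < q → q ≤ m → R p q
    spread {p} {suc q} s (s≤s p≤q) q<m with spread-last s p≤q q<m | m≤n⇒m<n∨m≡n p≤q
    ... | Rq , _ | inj₂ refl = Rq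
    ... | Rq , t | inj₁ p<q  = R-trans (spread t p<q (<⇒≤ q<m)) Rq

  -- To meet beyond a wall `d` both tokens would have to cross it, and a letter occurring once takes
  -- only one of them across. They cannot meet on a wall either: before the sole occurrence of its
  -- letter nothing has crossed it.
  block-inversion : {x : Word m} → (∀ {d} → d ∉ I → Once x d) →
                    ∀ {p q} → p < q → SameBlock I p q → (inv : Inversion x p q) →
                    let k = Inversion.letter inv in k ∈ I × SameBlock I p (toℕ k)
  block-inversion once {p} {q} p<q s (inversion u k v refl lo hi) = k∈I , same to from
    where
    k∈I : k ∈ I
    k∈I with k ∈? I
    ... | yes k∈I = k∈I
    ... | no  k∉I with avoid-toℕ (proj₁ (once-split u v (once k∉I))) | p ≤? toℕ k
    ... | u∌k | yes p≤k =
      contradiction (subst (_≤ toℕ k) hi (pos-≤ u u∌k (s .≤⇒ k∉I p≤k))) (<⇒≱ (n<1+n _))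
    ... | u∌k | no  p≰k = contradiction (subst (toℕ k <_) lo (pos-> u u∌k (≰⇒> p≰k))) (n≮n _)

    to : ∀ {d} → d ∉ I → p ≤ toℕ d → toℕ k ≤ toℕ d
    to {d} d∉I p≤d with one-stays-≤ u (once-++ˡ u (once d∉I)) (<⇒≢ p<q) p≤d (s .≤⇒ d∉I p≤d)
    ... | inj₁ le = subst (_≤ toℕ d) lo le
    ... | inj₂ le = <⇒≤ (subst (_≤ toℕ d) hi le)

    from : ∀ {d} → d ∉ I → toℕ k ≤ toℕ d → p ≤ toℕ d
    from {d} d∉I k≤d with p ≤? toℕ d
    ... | yes p≤d = p≤d
    ... | no  p≰d with one-stays-> u (once-++ˡ u (once d∉I)) (<⇒≢ p<q) (≰⇒> p≰d)
                        (≰⇒> (p≰d ∘ s .≤⇐ d∉I))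
    ... | inj₁ lt = contradiction k≤d (<⇒≱ (subst (toℕ d <_) lo lt))
    -- If only the upper token, now at `suc (toℕ k)`, is known to be above `d`, then `k` equals `d`,
    -- although `k` is in `I` and `d` is not.
    ... | inj₂ lt with ≤-antisym k≤d (s≤s⁻¹ (subst (toℕ d <_) hi lt))
    ... | e = contradiction (subst (_∈ I) (toℕ-injective e) k∈I) d∉I

-- Cuts as walls, and division by a word in `I`.

data Wall (I : Subset m) : ℕ → Set where
  bottom : Wall I 0
  top    : Wall I (suc m)
  cut    : ∀ {d} → d ∉ I → Wall I (label d)

record Block (I : Subset m) (a b : ℕ) : Set where
  field
    wallˡ    : Wall I a
    wallʳ    : Wall I b
    proper   : a < b
    interior : ∀ {i} → Inside a b i → i ∈ I
open Block public

module _ {I : Subset m} where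

  wall-≢ : ∀ {c i} → Wall I c → i ∈ I → label i ≢ c
  wall-≢ {i = i} top     _   e = <⇒≢ (s≤s (toℕ<n i)) e
  wall-≢ (cut d∉I)       i∈I e = d∉I (subst (_∈ I) (toℕ-injective (suc-injective e)) i∈I)

  wall-≤ : ∀ {c} → Wall I c → c ≤ suc m
  wall-≤ bottom          = z≤n
  wall-≤ top             = ≤-refl
  wall-≤ (cut {d} d∉I)   = <⇒≤ (s≤s (toℕ<n d))

  wall-same-≤ : ∀ {c} {i j : Fin m} → Wall I c → SameBlock I (toℕ i) (toℕ j) → c < label i → c < label j
  wall-same-≤         bottom    s _ = s≤s z≤n
  wall-same-≤ {i = i} top       s c<i = contradiction c<i (<⇒≯ (s≤s (toℕ<n i)))
  wall-same-≤         (cut d∉I) s (s≤s d<i) = s≤s (≰⇒> λ j≤d → <⇒≱ d<i (s .≤⇐ d∉I j≤d))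

  wall-same-≥ : ∀ {c} {i j : Fin m} → Wall I c → j ∈ I → SameBlock I (toℕ i) (toℕ j) → label i < c → label j < c
  wall-same-≥ {j = j} top       j∈I s _ = s≤s (toℕ<n j)
  wall-same-≥         (cut d∉I) j∈I s (s≤s i<d) =
    ≤∧≢⇒< (s≤s (s .≤⇒ d∉I (<⇒≤ i<d))) (wall-≢ (cut d∉I) j∈I)

  same-inside : ∀ {a b i j} → Wall I a → Wall I b → i ∈ I → j ∈ I → SameBlock I (toℕ i) (toℕ j) →
                # inside? a b ∈ [ i ] ≡ # inside? a b ∈ [ j ]
  same-inside {a} {b} wa wb i∈I j∈I s = count-letter (inside? a b)
    (λ (a<i , i<b) → wall-same-≤ wa s a<i , wall-same-≥ wb j∈I s i<b)
    (λ (a<j , j<b) → wall-same-≤ wa (same-sym s) a<j , wall-same-≥ wb i∈I (same-sym s) j<b)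

  -- As built by `divide`, `word` is `x` with one letter struck out per letter of `y`; `counts`
  -- records that each strike falls in the block of that letter.
  record Quotient (y x : Word m) : Set where
    constructor quotient
    field
      word    : Word m
      word-≅  : word ≅ y ++ x
      least   : Minimal word
      once    : ∀ {d} → d ∉ I → Once word d
      counts  : ∀ {a b} → Wall I a → Wall I b →
                # inside? a b ∈ word + # inside? a b ∈ y ≡ # inside? a b ∈ x

  module _ (x : Word m) (x-min : Minimal x) (x-once : ∀ {d} → d ∉ I → Once x d)
           (x-desc : ∀ {j} → j ∈ I → Descent x j) where

    divide : (y : Word m) → Minimal y → All (_∈ I) y → Quotient y x
    divide [] _ _ = quotient x ≅-refl x-min x-once (λ _ _ → +-identityʳ _)
    divide (j ∷ y) jy-min (j∈I ∷ y⊆I) with Minimal-∷⁻ jy-min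
    ... | y-min , asc with divide y y-min y⊆I
    ... | quotient z z≅yx z-min z-once counts = shorten
            (find-inversion z (n<1+n _) z-desc)
      where
      z-desc : Descent z j
      -- `y` carries `j` and `j + 1` to an increasing pair of one block, and `x` reverses every such
      -- pair.
      z-desc = Descent-≅ j (≅-sym z≅yx) (subst₂ _<_ (sym (pos-++ y x _)) (sym (pos-++ y x _))
        (spread {R = λ p q → pos x q < pos x p} (λ qp rq → <-trans rq qp) x-desc
          (same-trans (same-sym (same-pos y y⊆I _)) (same-trans (same-suc j∈I) (same-pos y y⊆I _)))
          asc (pos-≤m y (toℕ<n j))))

      shorten : Inversion z (toℕ j) (suc (toℕ j)) → Quotient (j ∷ y) x
      shorten found@(inversion u k v refl _ _) = quotient (u ++ v)
        (≅-trans (deletion z j found) (∷-cong j z≅yx))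
        (Minimal-deletion z-min (deletion z j found) (length-deletion u v))
        (once-insert u k v ∘ z-once)
        new-counts
        where
        new-counts : ∀ {a b} → Wall I a → Wall I b →
          # inside? a b ∈ (u ++ v) + # inside? a b ∈ (j ∷ y) ≡ # inside? a b ∈ x
        -- The letter struck out lies in the block of `j`, so trading `k` for `j` alters no count
        -- between walls.
        new-counts {a} {b} wa wb with block-inversion z-once (n<1+n _) (same-suc j∈I) found
        ... | k∈I , s = begin
          c (u ++ v) + c (j ∷ y)         ≡⟨ cong (c (u ++ v) +_) (count-++ (inside? a b) [ j ] y) ⟩
          c (u ++ v) + (c [ j ] + c y)   ≡⟨ cong (λ n → c (u ++ v) + (n + c y)) (same-inside wa wb j∈I k∈I s) ⟩
          c (u ++ v) + (c [ k ] + c y)   ≡⟨ sym (+-assoc (c (u ++ v)) _ _) ⟩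
          c (u ++ v) + c [ k ] + c y     ≡⟨ cong (_+ c y) (+-comm (c (u ++ v)) _) ⟩
          c [ k ] + c (u ++ v) + c y     ≡⟨ cong (_+ c y) (sym (count-++ (inside? a b) [ k ] (u ++ v))) ⟩
          c (k ∷ u ++ v) + c y           ≡⟨ cong (_+ c y) (sym (count-insert (inside? a b) u k v)) ⟩
          c (u ++ k ∷ v) + c y           ≡⟨ counts wa wb ⟩
          c x                            ∎
          where
          open ≡-Reasoning
          c : Word m → ℕ
          c = # inside? a b ∈_

-- Inversion numbers and binomial coefficients.

suc-C-2 : ∀ n → suc n C 2 ≡ n + n C 2
suc-C-2 n = trans (sym (nCk+nC[k+1]≡[n+1]C[k+1] n 1)) (cong (_+ n C 2) (nC1≡n n))

𝟙 : {A : Set} → Dec A → ℕ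
𝟙 (yes _) = 1
𝟙 (no _)  = 0

𝟙≤1 : {A : Set} (d : Dec A) → 𝟙 d ≤ 1
𝟙≤1 (yes _) = s≤s z≤n
𝟙≤1 (no _)  = z≤n

𝟙-yes : {A : Set} (d : Dec A) → A → 𝟙 d ≡ 1
𝟙-yes (yes _) _ = refl
𝟙-yes (no ¬a) a = contradiction a ¬a

𝟙-no : {A : Set} (d : Dec A) → ¬ A → 𝟙 d ≡ 0
𝟙-no (yes a) ¬a = contradiction a ¬a
𝟙-no (no _)  _  = refl

exceeding : (ℕ → ℕ) → ℕ → ℕ → ℕ
exceeding g zero    v = 0
exceeding g (suc n) v = 𝟙 (v <? g n) + exceeding g n v

-- The inversion number of the first `n` values of `g`, each pair being charged to its later member.
inversions : (ℕ → ℕ) → ℕ → ℕ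
inversions g zero    = 0
inversions g (suc n) = exceeding g n (g n) + inversions g n

module _ {g h : ℕ → ℕ} where

  exceeding-cong : ∀ n v → (∀ {p} → p < n → g p ≡ h p) → exceeding g n v ≡ exceeding h n v
  exceeding-cong zero    v e = refl
  exceeding-cong (suc n) v e =
    cong₂ _+_ (cong (λ u → 𝟙 (v <? u)) (e (n<1+n n))) (exceeding-cong n v (e ∘ m<n⇒m<1+n))

  inversions-cong : ∀ n → (∀ {p} → p < n → g p ≡ h p) → inversions g n ≡ inversions h n
  inversions-cong zero    e = refl
  inversions-cong (suc n) e = cong₂ _+_
    (trans (cong (exceeding g n) (e (n<1+n n))) (exceeding-cong n (h n) (e ∘ m<n⇒m<1+n)))
    (inversions-cong n (e ∘ m<n⇒m<1+n))

σ-below : ∀ {k p} → p < k → σ k p ≡ p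
σ-below {k} {p} p<k = σ-fix k p (<⇒≢ p<k) (<⇒≢ (m<n⇒m<1+n p<k))

σ-above : ∀ {k p} → suc k < p → σ k p ≡ p
σ-above {k} {p} 1+k<p = σ-fix k p (>⇒≢ (<-trans (n<1+n k) 1+k<p)) (>⇒≢ 1+k<p)

module _ (g : ℕ → ℕ) {k : ℕ} where

  exceeding-σ : ∀ {n} v → suc k < n → exceeding (g ∘ σ k) n v ≡ exceeding g n v
  exceeding-σ {suc n} v (s≤s 1+k≤n) with m≤n⇒m<n∨m≡n 1+k≤n
  ... | inj₁ 1+k<n = cong₂ _+_
    (cong (λ p → 𝟙 (v <? g p)) (σ-above 1+k<n)) (exceeding-σ v 1+k<n)
  ... | inj₂ refl
    rewrite σ-right k | σ-left k
          | exceeding-cong {g ∘ σ k} {g} k v (cong g ∘ σ-below) =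
    x∙yz≈y∙xz +-commutativeSemigroup (𝟙 (v <? g k)) (𝟙 (v <? g (suc k))) (exceeding g k v)

  -- Exchanging two neighbouring values in increasing order creates one inversion between them and
  -- only permutes the comparisons with all other places.
  inversions-σ : ∀ {n} → suc k < n → g k < g (suc k) →
                 inversions (g ∘ σ k) n ≡ suc (inversions g n)
  inversions-σ {suc n} (s≤s 1+k≤n) asc with m≤n⇒m<n∨m≡n 1+k≤n
  ... | inj₁ 1+k<n rewrite σ-above 1+k<n | exceeding-σ (g n) 1+k<n | inversions-σ 1+k<n asc =
    +-suc _ _
  -- The two values end the sequence: their rows trade places, and the indicator that compares them
  -- goes from 0 to 1.
  ... | inj₂ refl
    rewrite σ-right k | σ-left k
          | exceeding-cong {g ∘ σ k} {g} k (g k) (cong g ∘ σ-below)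
          | exceeding-cong {g ∘ σ k} {g} k (g (suc k)) (cong g ∘ σ-below)
          | inversions-cong {g ∘ σ k} {g} k (cong g ∘ σ-below)
          | 𝟙-yes (g k <? g (suc k)) asc | 𝟙-no (g (suc k) <? g k) (<⇒≯ asc) =
    cong suc (x∙yz≈y∙xz +-commutativeSemigroup (exceeding g k (g k)) (exceeding g k (g (suc k))) (inversions g k))

module _ (g : ℕ → ℕ) where
  exceeding-≤ : ∀ n v → exceeding g n v ≤ n
  exceeding-≤ zero    v = z≤n
  exceeding-≤ (suc n) v = +-mono-≤ (𝟙≤1 (v <? g n)) (exceeding-≤ n v)

  inversions-≤ : ∀ n → inversions g n ≤ n C 2
  inversions-≤ zero    = z≤n
  inversions-≤ (suc n) rewrite suc-C-2 n = +-mono-≤ (exceeding-≤ n (g n)) (inversions-≤ n)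

  exceeding-all : ∀ n {v} → (∀ {p} → p < n → v < g p) → exceeding g n v ≡ n
  exceeding-all zero    _  = refl
  exceeding-all (suc n) {v} lt = cong₂ _+_ (𝟙-yes (v <? g n) (lt (n<1+n n))) (exceeding-all n (lt ∘ m<n⇒m<1+n))

  inversions-decreasing : ∀ n → (∀ {p q} → p < q → q < n → g q < g p) → inversions g n ≡ n C 2
  inversions-decreasing zero    _   = refl
  inversions-decreasing (suc n) dec rewrite suc-C-2 n = cong₂ _+_
    (exceeding-all n (λ p<n → dec p<n (n<1+n n)))
    (inversions-decreasing n (λ p<q q<n → dec p<q (m<n⇒m<1+n q<n)))

  inversions-increasing : ∀ n → (∀ {p q} → p < q → q < n → g p < g q) → inversions g n ≡ 0
  inversions-increasing zero    _   = refl
  inversions-increasing (suc n) inc = cong₂ _+_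
    (none n (λ p<n → inc p<n (n<1+n n))) (inversions-increasing n (λ p<q q<n → inc p<q (m<n⇒m<1+n q<n)))
    where
    none : ∀ n {v} → (∀ {p} → p < n → g p < v) → exceeding g n v ≡ 0
    none zero    _  = refl
    none (suc n) {v} lt = cong₂ _+_ (𝟙-no (v <? g n) (<⇒≯ (lt (n<1+n n)))) (none n (lt ∘ m<n⇒m<1+n))

σ-shift : ∀ a k p → σ (a + k) (a + p) ≡ a + σ k p
σ-shift zero    k p = refl
σ-shift (suc a) k p = cong suc (σ-shift a k p)

module _ {I : Subset m} {a n : ℕ} (wa : Wall I a) (wb : Wall I (a + n)) where

  -- A letter between the two walls exchanges neighbours of the window which, by minimality, the
  -- rest of the word keeps in order, so it adds one inversion. Any other letter fixes the window
  -- pointwise, since no letter of `I` sits on a wall.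
  inside-count : (y : Word m) → Minimal y → All (_∈ I) y →
                 # inside? a (a + n) ∈ y ≡ inversions (λ p → pos y (a + p)) n
  inside-count [] _ _ = sym (inversions-increasing (a +_) n (λ p<q _ → +-monoʳ-< a p<q))
  inside-count (j ∷ y) jy-min (j∈I ∷ y⊆I) with Minimal-∷⁻ jy-min
  ... | y-min , asc with inside-count y y-min y⊆I | inside? a (a + n) j
  ... | ih | no ¬in = trans (trans (count-no (inside? a (a + n)) y ¬in) ih)
    (inversions-cong n λ {p} p<n → cong (pos y) (sym (fixed p<n)))
    where
    fixed : ∀ {p} → p < n → σ (toℕ j) (a + p) ≡ a + p
    fixed {p} p<n with <-cmp a (label j)
    ... | tri> _ _ j<a = σ-above (≤-trans j<a (m≤m+n a p))
    ... | tri≈ _ e _   = contradiction (sym e) (wall-≢ wa j∈I)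
    ... | tri< a<j _ _ with <-cmp (label j) (a + n)
    ... | tri< j<b _ _ = contradiction (a<j , j<b) ¬in
    ... | tri≈ _ e _   = contradiction e (wall-≢ wb j∈I)
    ... | tri> _ _ b<j = σ-below (<-≤-trans (+-monoʳ-< a p<n) (s≤s⁻¹ b<j))
  ... | ih | yes in-ab@(s≤s a≤j , j<b) with toℕ j ∸ a | m+[n∸m]≡n a≤j
  -- `k` is the position of `j` within the window, where `σ (toℕ j)` acts as `σ k`.
  ... | k | e = trans (trans (count-yes (inside? a (a + n)) y in-ab) (cong suc ih)) (sym (trans
    (inversions-cong n (λ {p} _ → cong (pos y) (trans (cong (λ t → σ t (a + p)) (sym e)) (σ-shift a k p))))
    (inversions-σ (λ p → pos y (a + p))
      (+-cancelˡ-< a _ _ (subst (_< a + n) (trans (cong suc (sym e)) (sym (+-suc a k))) j<b))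
      (subst₂ _<_ (cong (pos y) (sym e)) (cong (pos y) (trans (cong suc (sym e)) (sym (+-suc a k)))) asc))))

-- Repeated letters in coset-minimal words.

++-assoc-≅ : (u v w : Word m) → (u ++ v) ++ w ≅ u ++ (v ++ w)
++-assoc-≅ u v w .at p = cong (λ x → pos x p) (++-assoc u v w)

Distinct : Word m → Set
Distinct x = ∀ d → Once x d

-- One of the two orientations of the Dynkin diagram: "up" and "down" are treated at once.
record Direction (m : ℕ) : Set₁ where
  field
    Next       : Fin m → Fin m → Set
    next?      : ∀ i j → Dec (Next i j)
    functional : ∀ {i j k} → Next i j → Next i k → j ≡ k
    injective  : ∀ {i j k} → Next i k → Next j k → i ≡ j
    far        : ∀ {i j} → ¬ Next i j → ¬ Next j i →
                 ∀ p → σ (toℕ i) (σ (toℕ j) p) ≡ σ (toℕ j) (σ (toℕ i) p)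
    braid      : ∀ {i j} → Next i j → ∀ p →
                 σ (toℕ i) (σ (toℕ j) (σ (toℕ i) p)) ≡ σ (toℕ j) (σ (toℕ i) (σ (toℕ j) p))

upward : Direction m
upward {m} = record
  { Next       = λ (i j : Fin m) → toℕ j ≡ suc (toℕ i)
  ; next?      = λ i j → toℕ j ℕ.≟ suc (toℕ i)
  ; functional = λ e f → toℕ-injective (trans e (sym f))
  ; injective  = λ e f → toℕ-injective (suc-injective (trans (sym e) f))
  ; far        = commuting
  ; braid      = λ {i} {j} e p → subst (λ t → σ (toℕ i) (σ t (σ (toℕ i) p)) ≡ σ t (σ (toℕ i) (σ t p)))
                                       (sym e) (σ-braid (toℕ i) p)
  }
  where
  commuting : ∀ {i j : Fin m} → ¬ toℕ j ≡ suc (toℕ i) → ¬ toℕ i ≡ suc (toℕ j) →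
              ∀ p → σ (toℕ i) (σ (toℕ j) p) ≡ σ (toℕ j) (σ (toℕ i) p)
  commuting {i} {j} ¬up ¬down p with <-cmp (toℕ i) (toℕ j)
  ... | tri< i<j _ _ = σ-comm (≤∧≢⇒< i<j (≢-sym ¬up)) p
  ... | tri≈ _ e _   = cong₂ (λ s t → σ s (σ t p)) e (sym e)
  ... | tri> _ _ j<i = sym (σ-comm (≤∧≢⇒< j<i (≢-sym ¬down)) p)

opposite : Direction m → Direction m
opposite δ = record
  { Next       = λ i j → Next j i
  ; next?      = λ i j → next? j i
  ; functional = injective
  ; injective  = functional
  ; far        = λ ¬up ¬down → far ¬down ¬up
  ; braid      = λ n p → sym (braid n p)
  }
  where open Direction δ

module _ (I : Subset m) where

  -- A minimal word of a minimal representative of a coset in W_I \ W.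
  record CosetMinimal (z : Word m) : Set where
    field
      least   : Minimal z
      ascents : ∀ {j} → j ∈ I → Ascent z j
  open CosetMinimal public

  -- A descent `j` of the prefix gives a word `j ∷ y` as long as `u`; putting it in place of `u`
  -- makes `j` a descent of the whole word.
  CosetMinimal-++ˡ : (u : Word m) {v : Word m} → CosetMinimal (u ++ v) → CosetMinimal u
  CosetMinimal-++ˡ u {v} c .least = Minimal-++ˡ u (c .least)
  CosetMinimal-++ˡ u {v} c .ascents {j} j∈I with ascent-or-descent u j
  ... | inj₁ asc = asc
  ... | inj₂ desc with descent-deletion u j desc
  ... | y , y≅ju , l = contradiction (c .ascents j∈I) (<⇒≯
    (Minimal-descent {y = y ++ v} (c .least)
      (++-congˡ v (≅-sym (∷-cancel y≅ju)))
      (trans (length-++ u) (trans (cong (_+ length v) l) (cong suc (sym (length-++ y)))))))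

  module _ (δ : Direction m) where
    open Direction δ

    Near : Fin m → Fin m → Set
    Near i j = Next i j ⊎ Next j i

    near? : ∀ i j → Dec (Near i j)
    near? i j = next? i j ⊎-dec next? j i

    commute : ∀ {j} (x : Word m) → All (λ i → ¬ Near i j) x → x ++ [ j ] ≅ j ∷ x
    commute []      _       .at p = refl
    commute {j} (i ∷ x) (a ∷ as) .at p =
      trans (commute x as .at _) (cong (pos x) (far (a ∘ inj₂) (a ∘ inj₁) p))

    to-front : ∀ {j} (u : Word m) {v : Word m} → All (λ i → ¬ Near i j) u → u ++ j ∷ v ≅ j ∷ u ++ v
    to-front {j} u {v} a = ≅-trans (≅-sym (++-assoc-≅ u [ j ] v)) (++-congˡ v (commute u a))

    -- With no neighbour before it, `j` would commute to the front and be a left descent in `I`.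
    near-before : ∀ {j} (u : Word m) {v : Word m} → CosetMinimal (u ++ j ∷ v) → j ∈ I →
                  ∃[ i ] (i ∈ₗ u × Near i j)
    near-before {j} u c j∈I with any? (λ i → near? i j) u
    ... | yes found = find found
    ... | no  none  = contradiction (c .ascents j∈I) (<⇒≯
      (Minimal-descent (c .least) (to-front u (All.¬Any⇒All¬ u none)) (length-deletion u _)))

    data Path : Fin m → Fin m → Set where
      stop : ∀ {k} → Path k k
      step : ∀ {i j k} → i ∈ I → Next i j → Path j k → Path i k

    path-∈ : ∀ {i k} → Path i k → i ≢ k → i ∈ I
    path-∈ stop           i≢k = contradiction refl i≢k
    path-∈ (step i∈I _ _) _   = i∈I

    path-next : ∀ {i j k} → Path i k → i ≢ k → Next i j → Path j k
    path-next stop              i≢k _   = contradiction refl i≢k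
    path-next (step _ i→j path) _   i→l with functional i→j i→l
    ... | refl = path

    -- `near-before` supplies an earlier neighbour `l`. If it lay on the side of `k`, the same claim
    -- for `l`, one step closer to `k`, would put `i` before `l` and hence twice in the word; and
    -- `k`, where the path ends, does not occur at all.
    previous : ∀ {i k} → Path i k → (u : Word m) {v : Word m} →
               let z = u ++ i ∷ v in CosetMinimal z → Distinct z → k ∉ₗ z →
               ∃[ j ] (j ∈ₗ u × Next j i)
    previous stop u _ _ k∉z = contradiction (∈-++⁺ʳ u (here refl)) k∉z
    previous (step i∈I i→j path) u c dist k∉z with near-before u c i∈I
    ... | l , l∈u , inj₁ l→i = l , l∈u , l→i
    ... | l , l∈u , inj₂ i→l with functional i→j i→l | ∈-∃++ l∈u
    ... | refl | s , t , refl with ++-assoc s (l ∷ t) (_ ∷ _)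
    ... | e with previous path s (subst CosetMinimal e c) (subst Distinct e dist) (subst (_ ∉ₗ_) e k∉z)
    ... | i′ , i′∈s , i′→l with injective i→l i′→l
    ... | refl = contradiction refl (All.lookup (proj₁ (once-split (s ++ l ∷ t) _ (dist _))) (∈-++⁺ˡ i′∈s))

    -- If the next letter `j` towards `k` is not in `v`, the two copies of `i` cancel across `v`. If
    -- it is, a braid move brings `j` to the front, where it is a forbidden left descent.
    no-repeat : ∀ {i k} → Path i k → (u v : Word m) → CosetMinimal (u ++ i ∷ v ++ [ i ]) →
                Distinct (u ++ i ∷ v) → k ∉ₗ u ++ i ∷ v → ⊥
    no-repeat {i} {k} path u v c dist k∉z = main
      where
      z-min : CosetMinimal (u ++ i ∷ v)
      z-min = CosetMinimal-++ˡ (u ++ i ∷ v)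
        (subst CosetMinimal (sym (++-assoc u (i ∷ v) [ i ])) c)

      i∉u,v = once-split u v (dist i)

      -- By `previous` the predecessor of `i` occurs in `u`; occurring only once, it is not in `v`.
      not-below : ∀ {l} → l ∈ₗ v → ¬ Next l i
      not-below l∈v l→i with previous path u z-min dist k∉z
      ... | i′ , i′∈u , i′→i with injective i′→i l→i | ∈-∃++ l∈v
      ... | refl | s , t , refl = contradiction refl (All.lookup
        (proj₁ (once-split (u ++ i ∷ s) t
          (subst (λ z → Once z i′) (sym (++-assoc u (i ∷ s) (i′ ∷ t))) (dist i′))))
        (∈-++⁺ˡ i′∈u))

      main : ⊥
      main with any? (next? i) v
      ... | no none = contradiction (c .least .shortest shorter) (<⇒≱ long)
        where
        shorter : u ++ v ≅ u ++ i ∷ v ++ [ i ]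
        shorter = ++-congʳ u (≅-sym (∷-cancel (commute v (All.tabulate λ l∈v →
          λ { (inj₁ l→i) → not-below l∈v l→i
            ; (inj₂ i→l) → All.lookup (All.¬Any⇒All¬ v none) l∈v i→l }))))
        long : length (u ++ v) < length (u ++ i ∷ v ++ [ i ])
        long rewrite length-deletion u {i} (v ++ [ i ]) | sym (++-assoc u v [ i ]) | length-++ (u ++ v) {[ i ]} =
          s≤s (m≤m+n _ 1)
      ... | yes found with find found
      ... | j , j∈v , i→j with ∈-∃++ j∈v
      ... | v₁ , v₂ , refl = contradiction (c .ascents j∈I) (<⇒≯
        (Minimal-descent (c .least) braided same-length))
        where
        i≢k : i ≢ _
        i≢k refl = k∉z (∈-++⁺ʳ u (here refl))

        j≢k : j ≢ _
        j≢k refl = k∉z (∈-++⁺ʳ u (there j∈v))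

        path′ : Path j _
        path′ = path-next path i≢k i→j

        -- Since `k` is missing, the path does not end at `j`, and its letters short of the end are
        -- in `I`.
        j∈I : j ∈ I
        j∈I = path-∈ path′ j≢k

        split : u ++ i ∷ v₁ ++ j ∷ v₂ ≡ (u ++ i ∷ v₁) ++ j ∷ v₂
        split = sym (++-assoc u (i ∷ v₁) (j ∷ v₂))

        j∉ = once-split (u ++ i ∷ v₁) v₂ (subst (λ z → Once z j) split (dist j))

        far-from-i : ∀ {w} → (∀ {l} → l ∈ₗ w → l ∈ₗ v) → All (_≢ j) w → All (λ l → ¬ Near l i) w
        far-from-i w⊆v j∉w = All.tabulate λ l∈w →
          λ { (inj₁ l→i) → not-below (w⊆v l∈w) l→i
            ; (inj₂ i→l) → All.lookup j∉w l∈w (functional i→l i→j) }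

        -- A successor of `j` occurring earlier than `j` would need, by `previous`, another `j`
        -- before it.
        not-above : ∀ {l} → l ∈ₗ u ++ i ∷ v₁ → ¬ Next j l
        not-above {l} l∈ j→l with ∈-∃++ l∈
        ... | s , t , e with trans split (trans (cong (_++ j ∷ v₂) e) (++-assoc s (l ∷ t) (j ∷ v₂)))
        ... | e′ with previous (path-next path′ j≢k j→l) s
                        (subst CosetMinimal e′ z-min) (subst Distinct e′ dist) (subst (_ ∉ₗ_) e′ k∉z)
        ... | j′ , j′∈s , j′→l with injective j→l j′→l
        ... | refl = All.lookup (proj₁ j∉) (subst (j ∈ₗ_) (sym e) (∈-++⁺ˡ j′∈s)) refl

        ⊆ : ∀ {l} → l ∈ₗ u ++ v₁ → l ∈ₗ u ++ i ∷ v₁ × l ≢ i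
        ⊆ l∈ with ∈-++⁻ u l∈
        ... | inj₁ l∈u = ∈-++⁺ˡ l∈u , All.lookup (proj₁ i∉u,v) l∈u
        ... | inj₂ l∈v₁ = ∈-++⁺ʳ u (there l∈v₁) , All.lookup (All.++⁻ˡ v₁ (proj₂ i∉u,v)) l∈v₁

        far-from-j : All (λ l → ¬ Near l j) (u ++ v₁)
        far-from-j = All.tabulate λ l∈ →
          λ { (inj₁ l→j) → proj₂ (⊆ l∈) (injective l→j i→j)
            ; (inj₂ j→l) → not-above (proj₁ (⊆ l∈)) j→l }

        -- The last `i` passes `v₂`, the first passes `v₁`, `i j i` becomes `j i j`, and its first
        -- `j` passes `v₁` and `u`.
        braided : u ++ i ∷ (v₁ ++ j ∷ v₂) ++ [ i ] ≅ j ∷ (u ++ v₁) ++ i ∷ j ∷ v₂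
        braided =
          ≅-trans (++-congʳ u (∷-cong i
            (≅-trans (++-assoc-≅ v₁ (j ∷ v₂) [ i ]) (++-congʳ v₁ (∷-cong j (commute v₂
              (far-from-i (λ l∈ → ∈-++⁺ʳ v₁ (there l∈)) (proj₂ j∉))))))))
          (≅-trans (++-congʳ u (≅-trans
            (≅-sym (to-front v₁ (far-from-i ∈-++⁺ˡ (All.tail (All.++⁻ʳ u (proj₁ j∉))))))
            (++-congʳ v₁ (pointwise λ p → cong (pos v₂) (braid i→j p)))))
          (≅-trans (≅-sym (++-assoc-≅ u v₁ _)) (to-front (u ++ v₁) far-from-j)))

        same-length : length (u ++ i ∷ (v₁ ++ j ∷ v₂) ++ [ i ]) ≡ suc (length ((u ++ v₁) ++ i ∷ j ∷ v₂))
        same-length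
          rewrite length-++ u {i ∷ (v₁ ++ j ∷ v₂) ++ [ i ]} | length-++ (v₁ ++ j ∷ v₂) {[ i ]}
                | length-++ v₁ {j ∷ v₂} | length-++ (u ++ v₁) {i ∷ j ∷ v₂} | length-++ u {v₁} =
          solve 3 (λ a b c → a :+ (con 1 :+ ((b :+ (con 1 :+ c)) :+ con 1)) :=
                             con 1 :+ ((a :+ b) :+ (con 2 :+ c))) refl (length u) (length v₁) (length v₂)
          where open +-*-Solver

-- Paths and missing letters inside a block.

module _ {m : ℕ} where
  open DecMembership {A = Fin m} _≟_ public using () renaming (_∈?_ to _∈ₗ?_)

module _ {I : Subset m} where

  path-up : ∀ n {i k : Fin m} → toℕ k ≡ toℕ i + n →
            (∀ {l} → toℕ i ≤ toℕ l → toℕ l ≤ toℕ k → l ∈ I) → Path I upward i k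
  path-up zero e _ with toℕ-injective (trans e (+-identityʳ _))
  ... | refl = stop
  path-up (suc n) {i} {k} e within with trans e (+-suc (toℕ i) n)
  ... | k≡ with subst (suc (toℕ i) ≤_) (sym k≡) (m≤m+n _ n)
  ... | i<k with fromℕ< (≤-<-trans i<k (toℕ<n k)) | toℕ-fromℕ< (≤-<-trans i<k (toℕ<n k))
  ... | j | j≡ = step (within ≤-refl (<⇒≤ i<k)) j≡ (path-up n (trans k≡ (cong (_+ n) (sym j≡)))
        (λ j≤l → within (<⇒≤ (subst (_≤ _) j≡ j≤l))))

  path-down : ∀ n {i k : Fin m} → toℕ i ≡ toℕ k + n →
              (∀ {l} → toℕ k ≤ toℕ l → toℕ l ≤ toℕ i → l ∈ I) → Path I (opposite upward) i k
  path-down zero e _ with toℕ-injective (trans e (+-identityʳ _))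
  ... | refl = stop
  path-down (suc n) {i} {k} e within with trans e (+-suc (toℕ k) n)
  ... | i≡ with subst (toℕ k + n <_) (sym i≡) (n<1+n _)
  ... | j<i with fromℕ< (<-trans j<i (toℕ<n i)) | toℕ-fromℕ< (<-trans j<i (toℕ<n i))
  ... | j | j≡ = step (within (≤-trans (m≤m+n _ n) (<⇒≤ j<i)) ≤-refl) (trans i≡ (cong suc (sym j≡)))
        (path-down n j≡ (λ k≤l l≤j → within k≤l (≤-trans l≤j (<⇒≤ (subst (_< toℕ i) (sym j≡) j<i)))))

module _ {a : ℕ} {k : Fin m} (a<k : a < label k) where

  count-suc : (z : Word m) → # inside? a (suc (label k)) ∈ z ≡ # inside? a (label k) ∈ z + # (_≟ k) ∈ z
  count-suc []      = refl
  count-suc (i ∷ z) with <-cmp (label i) (label k)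
  ... | tri≈ i≮k e _ with toℕ-injective (suc-injective e)
  ... | refl = trans (count-yes (inside? a (suc (label k))) z (a<k , n<1+n _))
    (trans (cong suc (count-suc z)) (trans (sym (+-suc _ _))
      (cong₂ _+_ (sym (count-no (inside? a (label k)) z (i≮k ∘ proj₂))) (sym (count-yes (_≟ k) z refl)))))
  count-suc (i ∷ z) | tri> i≮k i≢k k<i = trans (count-no (inside? a (suc (label k))) z (λ (_ , i<) → <⇒≱ k<i (s≤s⁻¹ i<)))
    (trans (count-suc z) (cong₂ _+_ (sym (count-no (inside? a (label k)) z (i≮k ∘ proj₂)))
      (sym (count-no (_≟ k) z (i≢k ∘ cong label)))))
  count-suc (i ∷ z) | tri< i<k i≢k _ with a <? label i
  ... | yes a<i = trans (count-yes (inside? a (suc (label k))) z (a<i , m<n⇒m<1+n i<k))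
    (trans (cong suc (count-suc z)) (cong₂ _+_ (sym (count-yes (inside? a (label k)) z (a<i , i<k)))
      (sym (count-no (_≟ k) z (i≢k ∘ cong label)))))
  ... | no a≮i = trans (count-no (inside? a (suc (label k))) z (a≮i ∘ proj₁))
    (trans (count-suc z) (cong₂ _+_ (sym (count-no (inside? a (label k)) z (a≮i ∘ proj₁)))
      (sym (count-no (_≟ k) z (i≢k ∘ cong label)))))

count-extend : ∀ {a b} {k : Fin m} → a < b → b ≡ label k → (z : Word m) →
               # inside? a (suc b) ∈ z ≡ # inside? a b ∈ z + # (_≟ k) ∈ z
count-extend a<k refl = count-suc a<k

inside-empty : ∀ a (z : Word m) → # inside? a (suc (a + 0)) ∈ z ≡ 0
inside-empty a z = count-∉ (inside? a (suc (a + 0))) z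
  (All.universal (λ i (a<i , i<b) → <⇒≱ a<i (subst (label i ≤_) (+-identityʳ a) (s≤s⁻¹ i<b))) z)

letter-at : ∀ {a n} → suc (a + suc n) ≤ suc m → ∃[ k ] (suc (a + n) ≡ label {m} k)
letter-at {m} {a} {n} le = fromℕ< lt , cong suc (sym (toℕ-fromℕ< lt))
  where
  lt : a + n < m
  lt = subst (_≤ m) (+-suc a n) (s≤s⁻¹ le)

-- With right end `suc (a + n)` exactly `n` labels lie strictly inside, and each contributes at most
-- 1.
distinct-count : ∀ a n (z : Word m) → suc (a + n) ≤ suc m → Distinct z →
                 # inside? a (suc (a + n)) ∈ z ≤ n
distinct-count a zero    z _  _    = ≤-reflexive (inside-empty a z)
distinct-count a (suc n) z le dist with letter-at {a = a} le
... | k , e rewrite +-suc a n =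
  subst₂ _≤_ (sym (count-extend (s≤s (m≤m+n a n)) e z)) (+-comm n 1)
    (+-mono-≤ (distinct-count a n z (m≤n⇒m≤1+n (s≤s⁻¹ le)) dist) (dist k))

-- Pigeonhole over the same `n` labels: if all of them occur in `z`, each contributes at least 1.
missing-letter : ∀ a n (z : Word m) → suc (a + n) ≤ suc m →
                 n ≤ # inside? a (suc (a + n)) ∈ z ⊎ ∃[ k ] (Inside a (suc (a + n)) k × k ∉ₗ z)
missing-letter a zero    z _  = inj₁ z≤n
missing-letter a (suc n) z le with letter-at {a = a} le
... | k , e rewrite +-suc a n with k ∈ₗ? z | missing-letter a n z (m≤n⇒m≤1+n (s≤s⁻¹ le))
... | no k∉z  | _ = inj₂ (k , (subst (a <_) e (s≤s (m≤m+n a n)) , s≤s (≤-reflexive (sym e))) , k∉z)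
... | yes _   | inj₂ (l , (a<l , l<b) , l∉z) = inj₂ (l , (a<l , m<n⇒m<1+n l<b) , l∉z)
... | yes k∈z | inj₁ ih = inj₁ (subst₂ _≤_ (+-comm n 1)
  (sym (count-extend (s≤s (m≤m+n a n)) e z)) (+-mono-≤ ih (count-∈ (_≟ k) k∈z refl)))

module _ {I : Subset m} where

  -- A block from `a` to `b` has `b ∸ a ∸ 1` labels, and `z` may use at most that many letters
  -- there; a repetition thus forces some label of the block to be missing.
  Roomy : Word m → Set
  Roomy z = ∀ {i} → i ∈ I → ∃₂ λ a b → Block I a b × Inside a b i × # inside? a b ∈ z < b ∸ a

  -- The orientation is chosen to lead from `i` to `k`; the letters in between are interior to the
  -- block and so lie in `I`.
  repeat-impossible : ∀ {i} (u v : Word m) → CosetMinimal I (u ++ i ∷ v ++ [ i ]) →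
    Distinct (u ++ i ∷ v) → ∀ {a b k} → Block I a b → Inside a b i → Inside a b k → k ∉ₗ u ++ i ∷ v → ⊥
  repeat-impossible {i} u v c dist {k = k} B (a<i , i<b) (a<k , k<b) k∉z with ≤-total (toℕ i) (toℕ k)
  ... | inj₁ i≤k = no-repeat I upward (path-up (toℕ k ∸ toℕ i) (sym (m+[n∸m]≡n i≤k))
    (λ i≤l l≤k → B .interior (<-≤-trans a<i (s≤s i≤l) , ≤-<-trans (s≤s l≤k) k<b))) u v c dist k∉z
  ... | inj₂ k≤i = no-repeat I (opposite upward) (path-down (toℕ i ∸ toℕ k) (sym (m+[n∸m]≡n k≤i))
    (λ k≤l l≤i → B .interior (<-≤-trans a<k (s≤s k≤l) , ≤-<-trans (s≤s l≤i) i<b))) u v c dist k∉z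

  -- Induction from the right: the prefix is already distinct, so only the last letter `i` could
  -- repeat. If its block has a letter missing from the prefix, `repeat-impossible` applies;
  -- otherwise the prefix fills the block and `i` exceeds the room.
  coset-minimal-distinct : {z : Word m} → Reverse z → CosetMinimal I z →
    (∀ {d} → d ∉ I → Once z d) → Roomy z → Distinct z
  coset-minimal-distinct []             _ _    _    d = z≤n
  coset-minimal-distinct (z ∶ rz ∶ʳ i) c once room = distinct
    where
    z-dist : Distinct z
    z-dist = coset-minimal-distinct rz (CosetMinimal-++ˡ I z c) (once-++ˡ z ∘ once) λ i∈I →
      let a , b , B , in-ab , lt = room i∈I in
      a , b , B , in-ab , ≤-<-trans (≤-trans (m≤m+n _ _) (≤-reflexive (sym (count-++ (inside? a b) z [ i ])))) lt

    i∉z : i ∉ₗ z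
    i∉z i∈z with i ∈? I
    ... | no i∉I = All.lookup (proj₁ (once-split z [] (once i∉I))) i∈z refl
    ... | yes i∈I with room i∈I
    ... | a , b , B , in-ab , lt with b ∸ suc a | m+[n∸m]≡n (B .proper)
    ... | n | refl with missing-letter a n z (wall-≤ (B .wallʳ)) | ∈-∃++ i∈z
    ... | inj₂ (k , in-k , k∉z) | u , v , refl = repeat-impossible u v
      (subst (CosetMinimal I) (++-assoc u (i ∷ v) [ i ]) c) z-dist B in-ab in-k k∉z
    ... | inj₁ full | _ = <⇒≱ lt (begin
      suc (a + n) ∸ a                            ≡⟨ cong (_∸ a) (sym (+-suc a n)) ⟩
      a + suc n ∸ a                              ≡⟨ m+n∸m≡n a (suc n) ⟩
      suc n                                      ≤⟨ s≤s full ⟩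
      suc (c′ z)                                 ≡⟨ +-comm 1 _ ⟩
      c′ z + 1                                   ≡⟨ cong (c′ z +_) (sym (count-yes (inside? a (suc (a + n))) [] in-ab)) ⟩
      c′ z + c′ [ i ]                            ≡⟨ sym (count-++ (inside? a (suc (a + n))) z [ i ]) ⟩
      c′ (z ++ [ i ])                            ∎)
      where
      open ≤-Reasoning
      c′ : Word m → ℕ
      c′ = # inside? a (suc (a + n)) ∈_

    distinct : Distinct (z ++ [ i ])
    distinct d rewrite count-++ (_≟ d) z [ i ] with i ≟ d
    ... | yes refl = ≤-reflexive (cong (_+ 1) (count-∉ (_≟ i) z (All.¬Any⇒All¬ z (i∉z ∘ Any.map sym))))
    ... | no  _    = subst (_≤ 1) (sym (+-identityʳ _)) (z-dist d)

-- Blocks cut out by the complement of `I`.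

module _ {I : Subset m} where

  ∈D⁺ : ∀ {d} → d ∉ I → d ∈ₗ D I
  ∈D⁺ {d} d∉I = ∈-filter⁺ (λ i → ¬? (i ∈? I)) (∈-allFin d) d∉I

  ∈D⁻ : ∀ {d} → d ∈ₗ D I → d ∉ I
  ∈D⁻ d∈D = proj₂ (∈-filter⁻ (λ i → ¬? (i ∈? I)) {xs = allFin m} d∈D)

  cuts-increasing : AllPairs _<_ (cuts I)
  cuts-increasing = All.++⁺ (All.map⁺ (All.universal (λ _ → s≤s z≤n) (D I))) (s≤s z≤n ∷ []) ∷
    AllPairs.++⁺
      (AllPairs.map⁺ (AllPairs.filter⁺ (λ i → ¬? (i ∈? I)) (AllPairs.tabulate⁺-< s≤s)))
      ([] ∷ [])
      (All.map⁺ (All.universal (λ d → s≤s (toℕ<n d) ∷ []) (D I)))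

  cuts-walls : All (Wall I) (cuts I)
  cuts-walls = bottom ∷ All.++⁺ (All.map⁺ (All.tabulate (λ d∈D → cut (∈D⁻ d∈D)))) (top ∷ [])

  -- `complete` keeps the interiors free of cuts: a letter outside `I` above `a` must be among the
  -- later cuts, none of which lies below `b`.
  blocks-between : ∀ {a cs} → AllPairs _<_ (a ∷ cs) → All (Wall I) (a ∷ cs) →
                   (∀ {d} → d ∉ I → a < label d → label d ∈ₗ cs) → Linked (Block I) (a ∷ cs)
  blocks-between {cs = []}         _                           _              _        = [-]
  blocks-between {a} {cs = b ∷ cs} ((a<b ∷ _) ∷ b<cs ∷ increasing) (wa ∷ wb ∷ ws) complete =
    record { wallˡ = wa ; wallʳ = wb ; proper = a<b ; interior = inner } ∷
    blocks-between (b<cs ∷ increasing) (wb ∷ ws) rest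
    where
    inner : ∀ {i} → Inside a b i → i ∈ I
    inner {i} (a<i , i<b) with i ∈? I
    ... | yes i∈I = i∈I
    ... | no  i∉I with complete i∉I a<i
    ... | here refl  = contradiction i<b (n≮n _)
    ... | there i∈cs = contradiction i<b (<⇒≯ (All.lookup b<cs i∈cs))
    rest : ∀ {d} → d ∉ I → b < label d → label d ∈ₗ cs
    rest d∉I b<d with complete d∉I (<-trans a<b b<d)
    ... | here refl  = contradiction b<d (n≮n _)
    ... | there d∈cs = d∈cs

  cuts-blocks : Linked (Block I) (cuts I)
  cuts-blocks = blocks-between cuts-increasing cuts-walls
    (λ d∉I _ → ∈-++⁺ˡ (∈-map⁺ label (∈D⁺ d∉I)))

  -- Both chains are walked together, so the block around `i` comes with `R` for the same two cuts.
  find-block : ∀ {R : ℕ → ℕ → Set} {i a cs} → i ∈ I → a < label i → suc m ∈ₗ a ∷ cs →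
               Linked (Block I) (a ∷ cs) → Linked R (a ∷ cs) →
               ∃₂ λ a b → Block I a b × Inside a b i × R a b
  find-block {i = i} _ a<i (here refl) _ _ = contradiction a<i (<⇒≯ (s≤s (toℕ<n i)))
  find-block {i = i} i∈I a<i (there top∈) (_∷_ {y = b} B Bs) (r ∷ rs) with <-cmp (label i) b
  ... | tri< i<b _ _ = _ , _ , B , (a<i , i<b) , r
  ... | tri≈ _ e _   = contradiction e (wall-≢ (B .wallʳ) i∈I)
  ... | tri> _ _ b<i = find-block i∈I b<i top∈ Bs rs

  block-of : ∀ {R : ℕ → ℕ → Set} {i} → i ∈ I → Linked R (cuts I) →
             ∃₂ λ a b → Block I a b × Inside a b i × R a b
  block-of i∈I rs = find-block i∈I (s≤s z≤n)
    (there (∈-++⁺ʳ (map label (D I)) (here refl))) cuts-blocks rs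

  block-same : ∀ {a b p q} → Block I a b → a ≤ p → p < q → q < b → SameBlock I p q
  block-same B a≤p p<q q<b = same
    (λ {d} d∉I p≤d → ≮⇒≥ λ d<q → d∉I (B .interior (s≤s (≤-trans a≤p p≤d) , ≤-<-trans d<q q<b)))
    (λ _ → ≤-trans (<⇒≤ p<q))

  block-count-≤ : ∀ {a b} → Block I a b → (y : Word m) → Minimal y → All (_∈ I) y →
                  # inside? a b ∈ y ≤ (b ∸ a) C 2
  block-count-≤ {a} {b} B y y-min y⊆I with b ∸ a | m+[n∸m]≡n (<⇒≤ (B .proper))
  ... | n | refl = subst (_≤ n C 2) (sym (inside-count (B .wallˡ) (B .wallʳ) y y-min y⊆I))
    (inversions-≤ _ n)

  -- Descents at the letters of `I` spread to all pairs of the block, so the bound of `inversions-≤`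
  -- is attained.
  block-count-longest : ∀ {a b} → Block I a b → (y : Word m) → Minimal y → All (_∈ I) y →
                        (∀ {j} → j ∈ I → Descent y j) → # inside? a b ∈ y ≡ (b ∸ a) C 2
  block-count-longest {a} {b} B y y-min y⊆I desc with b ∸ a | m+[n∸m]≡n (<⇒≤ (B .proper))
  ... | n | refl = trans (inside-count (B .wallˡ) (B .wallʳ) y y-min y⊆I)
    (inversions-decreasing _ n λ {p} {q} p<q q<n →
      spread {R = λ p q → pos y q < pos y p} (λ qp rq → <-trans rq qp) desc
        (block-same B (m≤m+n a p) (+-monoʳ-< a p<q) (+-monoʳ-< a q<n)) (+-monoʳ-< a p<q)
        (s≤s⁻¹ (≤-trans (+-monoʳ-< a q<n) (wall-≤ (B .wallʳ)))))

  -- `y` sends `j`, `j + 1` to a decreasing pair of one block, and `x` reverses every pair of a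
  -- block; the two reversals cancel. For a word `y` of w₀(I) this removes all left descents in `I`.
  longest-ascents : (y x : Word m) → All (_∈ I) y → (∀ {j} → j ∈ I → Descent y j) →
                    (∀ {j} → j ∈ I → Descent x j) → ∀ {j} → j ∈ I → Ascent (y ++ x) j
  longest-ascents y x y⊆I y-desc x-desc {j} j∈I =
    subst₂ _<_ (sym (pos-++ y x _)) (sym (pos-++ y x _))
      (spread {R = λ p q → pos x q < pos x p} (λ qp rq → <-trans rq qp) x-desc
        (same-trans (same-sym (same-pos y y⊆I _)) (same-trans (same-sym (same-suc j∈I)) (same-pos y y⊆I _)))
        (y-desc j∈I) (pos-≤m y (<⇒≤ (toℕ<n j))))

  -- Additivity of lengths: an ascent of `y` at a letter of `I` stays one for `y ++ z`, because `y`
  -- keeps the pair in its block and `z` preserves the order inside blocks.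
  Minimal-++⁺ : (y : Word m) {z : Word m} → Minimal y → All (_∈ I) y → CosetMinimal I z →
                Minimal (y ++ z)
  Minimal-++⁺ []      _     _           z-min = z-min .least
  Minimal-++⁺ (j ∷ y) {z} jy-min (j∈I ∷ y⊆I) z-min with Minimal-∷⁻ jy-min
  ... | y-min , asc = Minimal-∷⁺ j (Minimal-++⁺ y y-min y⊆I z-min)
    (subst₂ _<_ (sym (pos-++ y z _)) (sym (pos-++ y z _))
      (spread {R = λ p q → pos z p < pos z q} <-trans (z-min .ascents)
        (same-trans (same-sym (same-pos y y⊆I _)) (same-trans (same-suc j∈I) (same-pos y y⊆I _)))
        asc (pos-≤m y (toℕ<n j))))

-- The first letter is absent from the rest, hence a wall for it, so the places on its two sides
-- stay in order.
distinct-minimal : (z : Word m) → Distinct z → Minimal z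
distinct-minimal []      _    = minimal λ _ → z≤n
distinct-minimal (j ∷ z) dist = Minimal-∷⁺ j
  (distinct-minimal z λ d → ≤-trans (count-≤-∷ (_≟ d) j z) (dist d))
  (≤-<-trans (pos-≤ z z∌j ≤-refl) (pos-> z z∌j (n<1+n _)))
  where z∌j = avoid-toℕ (once-∷ z (dist j))

-- Translation between words and permutations.

toℕ-s : (i : Fin m) (p : Fin (suc m)) → toℕ (s i ⟨$⟩ˡ p) ≡ σ (toℕ i) (toℕ p)
toℕ-s i p with p ≟ suc i
... | yes refl = trans (toℕ-inject₁ i) (sym (σ-right (toℕ i)))
... | no p≢1+i with p ≟ inject₁ i
... | yes refl = sym (trans (cong (σ (toℕ i)) (toℕ-inject₁ i)) (σ-left (toℕ i)))
... | no p≢i = sym (σ-fix (toℕ i) (toℕ p)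
  (λ e → p≢i (toℕ-injective (trans e (sym (toℕ-inject₁ i))))) (p≢1+i ∘ toℕ-injective))

toℕ-⟦⟧ : (x : Word m) (p : Fin (suc m)) → toℕ (⟦ x ⟧ ⟨$⟩ˡ p) ≡ pos x (toℕ p)
toℕ-⟦⟧ []      p = refl
toℕ-⟦⟧ (i ∷ x) p = trans (toℕ-⟦⟧ x (s i ⟨$⟩ˡ p)) (cong (pos x) (toℕ-s i p))

flip-cong : {u v : 𝔖 m} → u ≈ v → flip u ≈ flip v
flip-cong {u = u} {v} e p = trans (sym (inverseˡ v))
  (cong (v ⟨$⟩ˡ_) (trans (sym (e _)) (inverseʳ u)))

≈⇒≅ : {x y : Word m} → ⟦ x ⟧ ≈ ⟦ y ⟧ → x ≅ y
≈⇒≅ {m} {x} {y} e .at p with p ≤? m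
... | no  p≰m = trans (pos->m x (≰⇒> p≰m)) (sym (pos->m y (≰⇒> p≰m)))
... | yes p≤m with fromℕ< (s≤s p≤m) | toℕ-fromℕ< (s≤s p≤m)
... | q | refl = trans (sym (toℕ-⟦⟧ x q))
  (trans (cong toℕ (flip-cong {u = ⟦ x ⟧} {⟦ y ⟧} e q)) (toℕ-⟦⟧ y q))

≅⇒≈ : {x y : Word m} → x ≅ y → ⟦ x ⟧ ≈ ⟦ y ⟧
≅⇒≈ {x = x} {y} e = flip-cong {u = flip ⟦ x ⟧} {flip ⟦ y ⟧} λ p →
  toℕ-injective (trans (toℕ-⟦⟧ x p) (trans (e .at _) (sym (toℕ-⟦⟧ y p))))

Reduced⁻ : {x : Word m} (w : 𝔖 (suc m)) → Reduced x w → Minimal x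
Reduced⁻ w (x≈w , shortest) = minimal λ {y} y≅x → shortest y (λ p → trans (≅⇒≈ y≅x p) (x≈w p))

Reduced⁺ : (x : Word m) (w : 𝔖 (suc m)) → ⟦ x ⟧ ≈ w → Minimal x → Reduced x w
Reduced⁺ x w x≈w x-min = x≈w , λ y y≈w →
  x-min .shortest (≈⇒≅ {x = y} {x} λ p → trans (y≈w p) (sym (x≈w p)))

⟦++⟧ : (x y : Word m) → ⟦ x ++ y ⟧ ≈ ⟦ x ⟧ · ⟦ y ⟧
⟦++⟧ []      y p = refl
⟦++⟧ (i ∷ x) y p = cong (s i ⟨$⟩ʳ_) (⟦++⟧ x y p)

⟦reverse⟧ : (x : Word m) → ⟦ reverse x ⟧ ≈ flip ⟦ x ⟧
⟦reverse⟧ x = flip-cong {u = flip ⟦ reverse x ⟧} {⟦ x ⟧} λ p → toℕ-injective (begin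
  toℕ (⟦ reverse x ⟧ ⟨$⟩ˡ p)                        ≡⟨ toℕ-⟦⟧ (reverse x) p ⟩
  pos (reverse x) (toℕ p)                           ≡⟨ cong (pos (reverse x) ∘ toℕ) (sym (inverseˡ ⟦ x ⟧)) ⟩
  pos (reverse x) (toℕ (⟦ x ⟧ ⟨$⟩ˡ (⟦ x ⟧ ⟨$⟩ʳ p))) ≡⟨ cong (pos (reverse x)) (toℕ-⟦⟧ x _) ⟩
  pos (reverse x) (pos x (toℕ (⟦ x ⟧ ⟨$⟩ʳ p)))      ≡⟨ pos-reverse x _ ⟩
  toℕ (⟦ x ⟧ ⟨$⟩ʳ p)                                ∎)
  where open ≡-Reasoning

reverse-All : {P : Pred (Fin m) 0ℓ} (x : Word m) → All P x → All P (reverse x)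
reverse-All x px = All.tabulate (λ i∈ → All.lookup px (reverse⁻ i∈))

W⇒word : {K : Subset m} {u : 𝔖 (suc m)} → W K u → ∃[ x ] (All (_∈ K) x × ⟦ x ⟧ ≈ u)
W⇒word (gen {i} i∈K) = [ i ] , i∈K ∷ [] , λ _ → refl
W⇒word unit = [] , [] , λ _ → refl
W⇒word (mul {u} {v} Wu Wv) with W⇒word Wu | W⇒word Wv
... | x , x⊆K , x≈u | y , y⊆K , y≈v = x ++ y , All.++⁺ x⊆K y⊆K ,
  λ p → trans (⟦++⟧ x y p) (trans (x≈u _) (cong (u ⟨$⟩ʳ_) (y≈v p)))
W⇒word (inv {u} Wu) with W⇒word Wu
... | x , x⊆K , x≈u = reverse x , reverse-All x x⊆K ,
  λ p → trans (⟦reverse⟧ x p) (flip-cong {u = ⟦ x ⟧} {u} x≈u p)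
W⇒word (resp u≈v Wu) with W⇒word Wu
... | x , x⊆K , x≈u = x , x⊆K , λ p → trans (x≈u p) (u≈v p)

word⇒W : {K : Subset m} (x : Word m) → All (_∈ K) x → W K ⟦ x ⟧
word⇒W []      _           = unit
word⇒W (i ∷ x) (i∈K ∷ x⊆K) = mul (gen i∈K) (word⇒W x x⊆K)

-- Longest elements and Coxeter elements as words.

record LongestWord (I : Subset m) (w₀ : 𝔖 (suc m)) : Set where
  field
    word     : Word m
    denotes  : ⟦ word ⟧ ≈ w₀
    least    : Minimal word
    inI      : All (_∈ I) word
    descents : ∀ {j} → j ∈ I → Descent word j

-- An ascent `j` in `I` of the reduced word `y` would make `j ∷ y` a reduced word of a longer
-- element of W_I.
longest-word : {I : Subset m} {w₀ : 𝔖 (suc m)} → IsLongest I w₀ → LongestWord I w₀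
longest-word {I = I} {w₀} (Ww₀ , longest) with W⇒word Ww₀
... | x , x⊆I , x≈w₀ with minimise x x⊆I
... | y , y≅x , y-min , y⊆I = record
  { word = y ; denotes = y≈w₀ ; least = y-min ; inI = y⊆I ; descents = desc }
  where
  y≈w₀ : ⟦ y ⟧ ≈ w₀
  y≈w₀ p = trans (≅⇒≈ y≅x p) (x≈w₀ p)
  desc : ∀ {j} → j ∈ I → Descent y j
  desc {j} j∈I with ascent-or-descent y j
  ... | inj₂ d = d
  ... | inj₁ a = contradiction
    (longest (word⇒W (j ∷ y) (j∈I ∷ y⊆I))
      (j ∷ y , Reduced⁺ (j ∷ y) ⟦ j ∷ y ⟧ (λ _ → refl) (Minimal-∷⁺ j y-min a) , refl)
      (y , Reduced⁺ y w₀ y≈w₀ y-min , refl))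
    (<⇒≱ (n<1+n _))

J⇒Descent : (w : 𝔖 (suc m)) (x : Word m) → ⟦ x ⟧ ≈ w → ∀ {j} → J w j → Descent x j
J⇒Descent w x x≈w {j} = subst₂ _<_ (at-word (suc j)) (trans (at-word (inject₁ j)) (cong (pos x) (toℕ-inject₁ j)))
  where
  at-word : ∀ p → toℕ (w ⟨$⟩ˡ p) ≡ pos x (toℕ p)
  at-word p = trans (cong toℕ (sym (flip-cong {u = ⟦ x ⟧} {w} x≈w p))) (toℕ-⟦⟧ x p)

letters : Word m → Subset m
letters z = tabulate (λ i → does (i ∈ₗ? z))

∈-letters⁺ : ∀ {z i} → i ∈ₗ z → i ∈ letters {m} z
∈-letters⁺ {z = z} {i} i∈z = lookup⇒[]= i _ (trans (lookup∘tabulate _ i) (dec-true (i ∈ₗ? z) i∈z))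

∈-letters⁻ : ∀ {z i} → i ∈ letters {m} z → i ∈ₗ z
∈-letters⁻ {z = z} {i} i∈ with i ∈ₗ? z | trans (sym (lookup∘tabulate (λ i → does (i ∈ₗ? z)) i)) ([]=⇒lookup i∈)
... | yes i∈z | _ = i∈z
... | no _    | ()

distinct⇒StandardCoxeter : {c : 𝔖 (suc m)} (z : Word m) → Distinct z → ⟦ z ⟧ ≈ c →
                           StandardCoxeter (letters z) c
distinct⇒StandardCoxeter z dist z≈c = z , All.tabulate ∈-letters⁺ ,
  (λ {i} i∈ → ≤-antisym (dist i) (count-∈ (_≟ i) (∈-letters⁻ {z = z} i∈) refl)) , z≈c

StandardCoxeter⇒distinct : {K : Subset m} {z : Word m} → All (_∈ K) z →
                           (∀ {i} → i ∈ K → # (_≟ i) ∈ z ≡ 1) → Distinct z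
StandardCoxeter⇒distinct {K = K} {z} z⊆K once d with d ∈? K
... | yes d∈K = ≤-reflexive (once d∈K)
... | no  d∉K = ≤-trans (≤-reflexive (count-∉ (_≟ d) z
  (All.map (λ i∈K i≡d → d∉K (subst (_∈ K) i≡d i∈K)) z⊆K))) z≤n

-- The two implications.

module _ (w : 𝔖 (suc m)) {I : Subset m} (I⊆J : ∀ {j} → j ∈ I → J w j)
         {w₀ : 𝔖 (suc m)} (lw : LongestWord I w₀) where
  open LongestWord lw renaming (word to y; least to y-min; inI to y⊆I; descents to y-desc)

  coxeter⇒word : ∃[ K ] StandardCoxeter K (w₀ · w) → ∃[ x ] (Reduced x w × S1 I x × S2 I x)
  coxeter⇒word (K , z , z⊆K , once , z≈w₀w) =
    y⁻¹ ++ z , Reduced⁺ (y⁻¹ ++ z) w x≈w (Minimal-++⁺ y⁻¹ y⁻¹-min y⁻¹⊆I z-min) ,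
    All.tabulate (s1 ∘ ∈D⁻) , Linked.map s2 cuts-blocks
    where
    -- The reversed word spells the inverse of `w₀`, and w is w₀⁻¹ (w₀ w).
    y⁻¹ = reverse y
    y⁻¹-min = Minimal-reverse y-min
    y⁻¹⊆I = reverse-All y y⊆I

    z-dist : Distinct z
    z-dist = StandardCoxeter⇒distinct z⊆K once

    x≈w : ⟦ y⁻¹ ++ z ⟧ ≈ w
    x≈w p = begin
      ⟦ y⁻¹ ++ z ⟧ ⟨$⟩ʳ p                  ≡⟨ ⟦++⟧ y⁻¹ z p ⟩
      ⟦ y⁻¹ ⟧ ⟨$⟩ʳ (⟦ z ⟧ ⟨$⟩ʳ p)          ≡⟨ ⟦reverse⟧ y _ ⟩
      ⟦ y ⟧ ⟨$⟩ˡ (⟦ z ⟧ ⟨$⟩ʳ p)            ≡⟨ flip-cong {u = ⟦ y ⟧} {w₀} denotes _ ⟩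
      w₀ ⟨$⟩ˡ (⟦ z ⟧ ⟨$⟩ʳ p)               ≡⟨ cong (w₀ ⟨$⟩ˡ_) (z≈w₀w p) ⟩
      w₀ ⟨$⟩ˡ (w₀ ⟨$⟩ʳ (w ⟨$⟩ʳ p))         ≡⟨ inverseˡ w₀ ⟩
      w ⟨$⟩ʳ p                             ∎
      where open ≡-Reasoning

    yx≅z : y ++ y⁻¹ ++ z ≅ z
    yx≅z .at p = trans (pos-++ y (y⁻¹ ++ z) p) (trans (pos-++ y⁻¹ z _) (cong (pos z) (pos-reverse y p)))

    z-min : CosetMinimal I z
    z-min .least = distinct-minimal z z-dist
    z-min .ascents j∈I = subst₂ _<_ (yx≅z .at _) (yx≅z .at _)
      (longest-ascents y (y⁻¹ ++ z) y⊆I y-desc (λ j∈I → J⇒Descent w (y⁻¹ ++ z) x≈w (I⊆J j∈I)) j∈I)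

    s1 : ∀ {d} → d ∉ I → Once (y⁻¹ ++ z) d
    s1 {d} d∉I rewrite count-++ (_≟ d) y⁻¹ z
      | count-∉ (_≟ d) y⁻¹ (All.map (λ i∈I i≡d → d∉I (subst (_∈ I) i≡d i∈I)) y⁻¹⊆I) = z-dist d

    s2 : ∀ {a b} → Block I a b → # inside? a b ∈ (y⁻¹ ++ z) < (b ∸ a + 1) C 2
    s2 {a} {b} B rewrite count-++ (inside? a b) y⁻¹ z | +-comm (b ∸ a) 1 | suc-C-2 (b ∸ a) | +-comm (b ∸ a) ((b ∸ a) C 2) =
      +-mono-≤-< (block-count-≤ B y⁻¹ y⁻¹-min y⁻¹⊆I) few
      where
      few : # inside? a b ∈ z < b ∸ a
      -- Writing `b` as `suc (a + n)` exposes the number `n` of labels inside the block.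
      few with b ∸ suc a | m+[n∸m]≡n (B .proper)
      ... | n | refl = subst (# inside? a (suc (a + n)) ∈ z <_)
        (sym (trans (cong (_∸ a) (sym (+-suc a n))) (m+n∸m≡n a (suc n))))
        (s≤s (distinct-count a n z (wall-≤ (B .wallʳ)) z-dist))

  word⇒coxeter : ∃[ x ] (Reduced x w × S1 I x × S2 I x) → ∃[ K ] StandardCoxeter K (w₀ · w)
  word⇒coxeter (x , red@(x≈w , _) , s1 , s2) = letters z ,
    distinct⇒StandardCoxeter {c = w₀ · w} z (coset-minimal-distinct (reverseView z) z-min once room) λ p →
      trans (≅⇒≈ word-≅ p) (trans (⟦++⟧ y x p) (trans (denotes _) (cong (w₀ ⟨$⟩ʳ_) (x≈w p))))
    where
    x-desc : ∀ {j} → j ∈ I → Descent x j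
    x-desc j∈I = J⇒Descent w x x≈w (I⊆J j∈I)

    open Quotient (divide x (Reduced⁻ w red) (λ d∉I → All.lookup s1 (∈D⁺ d∉I)) x-desc y y-min y⊆I)
      renaming (word to z; least to z-least)

    z-min : CosetMinimal I z
    z-min .least = z-least
    z-min .ascents j∈I = subst₂ _<_ (sym (word-≅ .at _)) (sym (word-≅ .at _))
      (longest-ascents y x y⊆I y-desc x-desc j∈I)

    room : Roomy {I = I} z
    room i∈I with block-of i∈I s2
    -- `y` uses exactly `(b ∸ a) C 2` letters of the block; taking these off the bound of `S2`
    -- leaves fewer than `b ∸ a` for `z`.
    ... | a , b , B , in-ab , lt = a , b , B , in-ab , +-cancelʳ-< ((b ∸ a) C 2) _ _ (begin-strict
      # inside? a b ∈ z + (b ∸ a) C 2           ≡⟨ cong (# inside? a b ∈ z +_) (sym (block-count-longest B y y-min y⊆I y-desc)) ⟩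
      # inside? a b ∈ z + # inside? a b ∈ y     ≡⟨ counts (B .wallˡ) (B .wallʳ) ⟩
      # inside? a b ∈ x                         <⟨ lt ⟩
      (b ∸ a + 1) C 2                           ≡⟨ cong (_C 2) (+-comm (b ∸ a) 1) ⟩
      suc (b ∸ a) C 2                           ≡⟨ suc-C-2 (b ∸ a) ⟩
      b ∸ a + (b ∸ a) C 2                       ∎)
      where open ≤-Reasoning

theorem1p3 : (m : ℕ) (w : 𝔖 (suc m)) (I : Subset m) →
    (∀ {j} → j ∈ I → J w j) →
    (w₀ : 𝔖 (suc m)) → IsLongest I w₀ →
    (∃[ K ] StandardCoxeter K (w₀ · w)) ⇔ (∃[ x ] (Reduced x w × S1 I x × S2 I x))
theorem1p3 m w I I⊆J w₀ longest = mk⇔ (coxeter⇒word w I⊆J lw) (word⇒coxeter w I⊆J lw)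
  where lw = longest-word longest
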